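{- There exist absolute constants $c,C>0$ such that for every four cycle-free Boolean matrix $M$ of degeneracy $d$, $$c\sqrt{d}\le \gamma_2(M)\le C\sqrt{d}.$$
   Context: A Boolean matrix is a matrix with entries in $\{0,1\}$. A submatrix is obtained by choosing an arbitrary subset of the rows and an arbitrary subset of the columns. A Boolean matrix is four cycle-free if it contains no $2\times 2$ all-ones submatrix. The degeneracy of a Boolean matrix $M$ is the smallest nonnegative integer $d$ such that every submatrix of $M$ has a row or a column with at most $d$ one entries. For a real matrix $M$, $\gamma_2(M)=\min_{UV=M}\|U\|_{\mathrm{row}}\|V\|_{\mathrm{col}}$, where the minimum is over all factorizations $M=UV$ into real matrices, $\|U\|_{\mathrm{row}}$ is the maximum $\ell_2$-norm of a row of $U$, and $\|V\|_{\mathrm{col}}$ is the maximum $\ell_2$-norm of a column of $V$. -}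

module Defs where

open import Data.Bool.Base using (Bool; true; if_then_else_)
open import Data.Fin.Base using (Fin)
open import Data.Fin.Subset using (Subset; Nonempty; _∈_; _∩_; ∣_∣)
open import Data.Integer.Base as ℤ using (+_)
import Data.Integer.Properties as ℤ
open import Data.Nat.Base as ℕ using (ℕ; zero; suc)
import Data.Nat.Properties as ℕ
open import Data.Product using (Σ-syntax; ∃-syntax; _×_; _,_)
open import Data.Rational.Base as ℚ using (ℚ; 0ℚ; 1ℚ; ½; *≤*)
import Data.Rational.Properties as ℚ
open import Data.Rational.Solver using (module +-*-Solver)
open import Data.Rational.Unnormalised.Base as ℚᵘ using (mkℚᵘ; *≡*)
import Data.Rational.Unnormalised.Properties as ℚᵘ
open import Data.Sum using (_⊎_; inj₁; inj₂)
open import Data.Vec.Base using (tabulate)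
open import Data.Vec.Functional using (foldr)
open import Function.Bundles using (_⇔_; mk⇔)
open import Relation.Nullary using (¬_; Dec; yes; no; contradiction)
open import Relation.Nullary.Decidable using (⌊_⌋)
open import Relation.Binary.PropositionalEquality
  using (_≡_; _≢_; refl; sym; trans; cong; cong₂; subst; subst₂)

------------------------------------------------------------------------
-- Arithmetic of ℚ

private
  open +-*-Solver using (solve; _:=_; _:+_; _:*_; _:-_; con)

  0≤q-p⇒p≤q : ∀ {p q} → 0ℚ ℚ.≤ q ℚ.- p → p ℚ.≤ q
  0≤q-p⇒p≤q {p} {q} h = subst₂ ℚ._≤_ (ℚ.+-identityˡ p)
    (solve 2 (λ q p → (q :- p) :+ p := q) refl q p) (ℚ.+-monoˡ-≤ p h)

  *-mono-≤ : ∀ {p q r s} → 0ℚ ℚ.≤ p → 0ℚ ℚ.≤ r → p ℚ.≤ q → r ℚ.≤ s →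
             p ℚ.* r ℚ.≤ q ℚ.* s
  *-mono-≤ {p} {q} {r} {s} 0≤p 0≤r p≤q r≤s = ℚ.≤-trans
    (ℚ.*-monoʳ-≤-nonNeg r {{ℚ.nonNegative 0≤r}} p≤q)
    (ℚ.*-monoˡ-≤-nonNeg q {{ℚ.nonNegative (ℚ.≤-trans 0≤p p≤q)}} r≤s)

  0≤* : ∀ {p q} → 0ℚ ℚ.≤ p → 0ℚ ℚ.≤ q → 0ℚ ℚ.≤ p ℚ.* q
  0≤* 0≤p 0≤q = *-mono-≤ ℚ.≤-refl ℚ.≤-refl 0≤p 0≤q

  0<* : ∀ {p q} → 0ℚ ℚ.< p → 0ℚ ℚ.< q → 0ℚ ℚ.< p ℚ.* q
  0<* {p} {q} 0<p 0<q = subst (ℚ._< p ℚ.* q) (ℚ.*-zeroʳ p)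
    (ℚ.*-monoʳ-<-pos p {{ℚ.positive 0<p}} 0<q)

  0<½ : 0ℚ ℚ.< ½
  0<½ = ℚ.*<* (ℤ.+<+ (ℕ.s≤s ℕ.z≤n))

  0≤1 : 0ℚ ℚ.≤ 1ℚ
  0≤1 = *≤* (ℤ.+≤+ ℕ.z≤n)

  0<1 : 0ℚ ℚ.< 1ℚ
  0<1 = ℚ.*<* (ℤ.+<+ (ℕ.s≤s ℕ.z≤n))

  half+half : ∀ p → ½ ℚ.* p ℚ.+ ½ ℚ.* p ≡ p
  half+half = solve 1 (λ p → con ½ :* p :+ con ½ :* p := p) refl

  p≤∣p∣ : ∀ p → p ℚ.≤ ℚ.∣ p ∣
  p≤∣p∣ p with ℚ.≤-total 0ℚ p
  ... | inj₁ 0≤p = ℚ.≤-reflexive (sym (ℚ.0≤p⇒∣p∣≡p 0≤p))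
  ... | inj₂ p≤0 = ℚ.≤-trans p≤0 (ℚ.0≤∣p∣ p)

  ∣p∣<-intro : ∀ {p q} → p ℚ.< q → ℚ.- p ℚ.< q → ℚ.∣ p ∣ ℚ.< q
  ∣p∣<-intro {p} p<q -p<q with ℚ.∣p∣≡p∨∣p∣≡-p p
  ... | inj₁ eq = subst (ℚ._< _) (sym eq) p<q
  ... | inj₂ eq = subst (ℚ._< _) (sym eq) -p<q

  swap- : ∀ p q → ℚ.- (p ℚ.- q) ≡ q ℚ.- p
  swap- = solve 2 (λ p q → +-*-Solver.:- (p :- q) := q :- p) refl

  ∣p-q∣-sym : ∀ p q → ℚ.∣ p ℚ.- q ∣ ≡ ℚ.∣ q ℚ.- p ∣
  ∣p-q∣-sym p q = trans (sym (ℚ.∣-p∣≡∣p∣ (p ℚ.- q))) (cong ℚ.∣_∣ (swap- p q))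

  ∣p-q∣<r⇒p<q+r : ∀ p q {r} → ℚ.∣ p ℚ.- q ∣ ℚ.< r → p ℚ.< q ℚ.+ r
  ∣p-q∣<r⇒p<q+r p q {r} h = subst (ℚ._< q ℚ.+ r)
    (solve 2 (λ p q → q :+ (p :- q) := p) refl p q)
    (ℚ.+-monoʳ-< q (ℚ.≤-<-trans (p≤∣p∣ (p ℚ.- q)) h))

  p<q+r⇒p-q<r : ∀ {p q r} → p ℚ.< q ℚ.+ r → p ℚ.- q ℚ.< r
  p<q+r⇒p-q<r {p} {q} {r} h = subst (p ℚ.- q ℚ.<_)
    (solve 2 (λ q r → (q :+ r) :- q := r) refl q r) (ℚ.+-monoˡ-< (ℚ.- q) h)

  ∣p-q∣<-intro : ∀ {p q r} → p ℚ.< q ℚ.+ r → q ℚ.< p ℚ.+ r →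
                 ℚ.∣ p ℚ.- q ∣ ℚ.< r
  ∣p-q∣<-intro {p} {q} {r} h k = ∣p∣<-intro (p<q+r⇒p-q<r h)
    (subst (ℚ._< r) (sym (swap- p q)) (p<q+r⇒p-q<r k))

------------------------------------------------------------------------
-- Real numbers: the setoid of Cauchy sequences of rationals

Eventually : (ℕ → Set) → Set
Eventually P = ∃[ N ] ∀ n → N ℕ.≤ n → P n

Cauchy : (ℕ → ℚ) → Set
Cauchy x = ∀ ε → 0ℚ ℚ.< ε →
  ∃[ N ] ∀ m n → N ℕ.≤ m → N ℕ.≤ n → ℚ.∣ x m ℚ.- x n ∣ ℚ.< ε

record ℝ : Set where
  no-eta-equality
  constructor mkℝ
  field
    seq    : ℕ → ℚ
    cauchy : Cauchy seq

open ℝ public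

infix 4 _≈_ _≤_ _<_

record _≈_ (x y : ℝ) : Set where
  constructor mk≈
  field close : ∀ ε → 0ℚ ℚ.< ε →
          Eventually λ n → ℚ.∣ seq x n ℚ.- seq y n ∣ ℚ.< ε

record _≤_ (x y : ℝ) : Set where
  constructor mk≤
  field below : ∀ ε → 0ℚ ℚ.< ε →
          Eventually λ n → seq x n ℚ.≤ seq y n ℚ.+ ε

record _<_ (x y : ℝ) : Set where
  constructor mk<
  field
    gap   : ℚ
    0<gap : 0ℚ ℚ.< gap
    apart : Eventually λ n → seq x n ℚ.+ gap ℚ.≤ seq y n

open _≈_ public
open _≤_ public
open _<_ public

fromℚ : ℚ → ℝ
fromℚ q = mkℝ (λ _ → q) λ ε 0<ε → 0 , λ _ _ _ _ →
  subst (ℚ._< ε) (sym (cong ℚ.∣_∣ (ℚ.+-inverseʳ q))) 0<ε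

ℕ→ℚ : ℕ → ℚ
ℕ→ℚ n = + n ℚ./ 1

fromℕ : ℕ → ℝ
fromℕ n = fromℚ (ℕ→ℚ n)

0ℝ 1ℝ : ℝ
0ℝ = fromℚ 0ℚ
1ℝ = fromℚ 1ℚ

private
  -- The Cauchy proofs are abstract only to keep type checking fast.
  abstract
    +-cauchy : ∀ x y → Cauchy x → Cauchy y → Cauchy (λ n → x n ℚ.+ y n)
    +-cauchy x y cx cy ε 0<ε
      with cx (½ ℚ.* ε) (0<* 0<½ 0<ε) | cy (½ ℚ.* ε) (0<* 0<½ 0<ε)
    ... | N , hx | N′ , hy = N ℕ.⊔ N′ , λ m n p q →
      ℚ.≤-<-trans
        (subst (λ z → ℚ.∣ z ∣ ℚ.≤ ℚ.∣ x m ℚ.- x n ∣ ℚ.+ ℚ.∣ y m ℚ.- y n ∣)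
          (solve 4 (λ a b c d → (a :- b) :+ (c :- d) := (a :+ c) :- (b :+ d))
            refl (x m) (x n) (y m) (y n))
          (ℚ.∣p+q∣≤∣p∣+∣q∣ (x m ℚ.- x n) (y m ℚ.- y n)))
        (subst (_ ℚ.<_) (half+half ε)
          (ℚ.+-mono-<
            (hx m n (ℕ.m⊔n≤o⇒m≤o N N′ p) (ℕ.m⊔n≤o⇒m≤o N N′ q))
            (hy m n (ℕ.m⊔n≤o⇒n≤o N N′ p) (ℕ.m⊔n≤o⇒n≤o N N′ q))))

  bounded : ∀ x → Cauchy x →
            ∃[ B ] 0ℚ ℚ.< B × Eventually λ n → ℚ.∣ x n ∣ ℚ.≤ B
  bounded x cx with cx 1ℚ 0<1
  ... | N , h = ℚ.∣ x N ∣ ℚ.+ 1ℚ , ℚ.+-mono-≤-< (ℚ.0≤∣p∣ (x N)) 0<1 , N , λ n p →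
    ℚ.≤-trans
      (subst (λ z → ℚ.∣ z ∣ ℚ.≤ ℚ.∣ x N ∣ ℚ.+ ℚ.∣ x n ℚ.- x N ∣)
        (solve 2 (λ a b → b :+ (a :- b) := a) refl (x n) (x N))
        (ℚ.∣p+q∣≤∣p∣+∣q∣ (x N) (x n ℚ.- x N)))
      (ℚ.+-monoʳ-≤ ℚ.∣ x N ∣ (ℚ.<⇒≤ (h n N p ℕ.≤-refl)))

  divide : ∀ {p q} → 0ℚ ℚ.< p → 0ℚ ℚ.< q → ∃[ r ] 0ℚ ℚ.< r × q ℚ.* r ≡ p
  divide {p} {q} 0<p 0<q =
    ℚ.1/ q ℚ.* p , 0<* (ℚ.positive⁻¹ (ℚ.1/ q) {{ℚ.1/pos⇒pos q}}) 0<p ,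
    trans (sym (ℚ.*-assoc q (ℚ.1/ q) p))
      (trans (cong (ℚ._* p) (ℚ.*-inverseʳ q)) (ℚ.*-identityˡ p))
    where
    instance
      q>0 = ℚ.positive 0<q
      q≢0 = ℚ.pos⇒nonZero q

  *-close : ∀ {a a′ b b′ A B α β ε} → 0ℚ ℚ.< A → 0ℚ ℚ.< B →
    ℚ.∣ a ∣ ℚ.≤ A → ℚ.∣ b′ ∣ ℚ.≤ B →
    ℚ.∣ a ℚ.- a′ ∣ ℚ.< α → ℚ.∣ b ℚ.- b′ ∣ ℚ.< β →
    A ℚ.* β ≡ ½ ℚ.* ε → B ℚ.* α ≡ ½ ℚ.* ε →
    ℚ.∣ a ℚ.* b ℚ.- a′ ℚ.* b′ ∣ ℚ.< ε
  *-close {a} {a′} {b} {b′} {A} {B} {α} {β} {ε} 0<A 0<B a≤ b′≤ a-a′ b-b′ eqA eqB =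
    subst₂ ℚ._<_ (cong ℚ.∣_∣ split) (half+half ε)
      (ℚ.≤-<-trans (ℚ.∣p+q∣≤∣p∣+∣q∣ (a ℚ.* (b ℚ.- b′)) (b′ ℚ.* (a ℚ.- a′)))
        (ℚ.+-mono-< (bound a (b ℚ.- b′) 0<A a≤ b-b′ eqA)
                    (bound b′ (a ℚ.- a′) 0<B b′≤ a-a′ eqB)))
    where
    split : a ℚ.* (b ℚ.- b′) ℚ.+ b′ ℚ.* (a ℚ.- a′) ≡ a ℚ.* b ℚ.- a′ ℚ.* b′
    split = solve 4 (λ a a′ b b′ →
      a :* (b :- b′) :+ b′ :* (a :- a′) := a :* b :- a′ :* b′) refl a a′ b b′

    bound : ∀ p q {P η ζ} → 0ℚ ℚ.< P → ℚ.∣ p ∣ ℚ.≤ P → ℚ.∣ q ∣ ℚ.< η →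
            P ℚ.* η ≡ ζ → ℚ.∣ p ℚ.* q ∣ ℚ.< ζ
    bound p q {P} 0<P p≤ q< refl = subst (ℚ._< _) (sym (ℚ.∣p*q∣≡∣p∣*∣q∣ p q))
      (ℚ.≤-<-trans (*-mono-≤ (ℚ.0≤∣p∣ p) (ℚ.0≤∣p∣ q) p≤ ℚ.≤-refl)
        (ℚ.*-monoʳ-<-pos P {{ℚ.positive 0<P}} q<))

  abstract
    *-cauchy : ∀ x y → Cauchy x → Cauchy y → Cauchy (λ n → x n ℚ.* y n)
    *-cauchy x y cx cy ε 0<ε =
      let A , 0<A , K , bx = bounded x cx
          B , 0<B , L , by = bounded y cy
          α , 0<α , eqB = divide (0<* 0<½ 0<ε) 0<B
          β , 0<β , eqA = divide (0<* 0<½ 0<ε) 0<A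
          M , hx = cx α 0<α
          N , hy = cy β 0<β
      in (K ℕ.⊔ L) ℕ.⊔ (M ℕ.⊔ N) , λ m n p q →
        let p₁ = ℕ.m⊔n≤o⇒m≤o (K ℕ.⊔ L) (M ℕ.⊔ N) p
            p₂ = ℕ.m⊔n≤o⇒n≤o (K ℕ.⊔ L) (M ℕ.⊔ N) p
            q₁ = ℕ.m⊔n≤o⇒m≤o (K ℕ.⊔ L) (M ℕ.⊔ N) q
            q₂ = ℕ.m⊔n≤o⇒n≤o (K ℕ.⊔ L) (M ℕ.⊔ N) q
        in *-close {x m} {x n} {y m} {y n} 0<A 0<B
             (bx m (ℕ.m⊔n≤o⇒m≤o K L p₁)) (by n (ℕ.m⊔n≤o⇒n≤o K L q₁))
             (hx m n (ℕ.m⊔n≤o⇒m≤o M N p₂) (ℕ.m⊔n≤o⇒m≤o M N q₂))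
             (hy m n (ℕ.m⊔n≤o⇒n≤o M N p₂) (ℕ.m⊔n≤o⇒n≤o M N q₂))
             eqA eqB

  ⊔-<-+ : ∀ a b c d {ε} → a ℚ.< c ℚ.+ ε → b ℚ.< d ℚ.+ ε →
          a ℚ.⊔ b ℚ.< c ℚ.⊔ d ℚ.+ ε
  ⊔-<-+ a b c d {ε} p q with ℚ.⊔-sel a b
  ... | inj₁ eq = subst (ℚ._< _) (sym eq)
                    (ℚ.<-≤-trans p (ℚ.+-monoˡ-≤ ε (ℚ.p≤p⊔q c d)))
  ... | inj₂ eq = subst (ℚ._< _) (sym eq)
                    (ℚ.<-≤-trans q (ℚ.+-monoˡ-≤ ε (ℚ.p≤q⊔p c d)))

  abstract
    ⊔-cauchy : ∀ x y → Cauchy x → Cauchy y → Cauchy (λ n → x n ℚ.⊔ y n)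
    ⊔-cauchy x y cx cy ε 0<ε with cx ε 0<ε | cy ε 0<ε
    ... | N , hx | N′ , hy = N ℕ.⊔ N′ , λ m n p q →
      let dx = hx m n (ℕ.m⊔n≤o⇒m≤o N N′ p) (ℕ.m⊔n≤o⇒m≤o N N′ q)
          dy = hy m n (ℕ.m⊔n≤o⇒n≤o N N′ p) (ℕ.m⊔n≤o⇒n≤o N N′ q)
      in ∣p-q∣<-intro
        (⊔-<-+ (x m) (y m) (x n) (y n)
             (∣p-q∣<r⇒p<q+r (x m) (x n) dx)
             (∣p-q∣<r⇒p<q+r (y m) (y n) dy))
        (⊔-<-+ (x n) (y n) (x m) (y m)
             (∣p-q∣<r⇒p<q+r (x n) (x m) (subst (ℚ._< ε) (∣p-q∣-sym (x m) (x n)) dx))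
             (∣p-q∣<r⇒p<q+r (y n) (y m) (subst (ℚ._< ε) (∣p-q∣-sym (y m) (y n)) dy)))

infixl 6 _+_ _⊔_
infixl 7 _*_

_+_ _*_ _⊔_ : ℝ → ℝ → ℝ
x + y = mkℝ (λ n → seq x n ℚ.+ seq y n) (+-cauchy (seq x) (seq y) (cauchy x) (cauchy y))
x * y = mkℝ (λ n → seq x n ℚ.* seq y n) (*-cauchy (seq x) (seq y) (cauchy x) (cauchy y))
x ⊔ y = mkℝ (λ n → seq x n ℚ.⊔ seq y n) (⊔-cauchy (seq x) (seq y) (cauchy x) (cauchy y))

------------------------------------------------------------------------
-- Square roots

1/suc : ℕ → ℚ
1/suc n = + 1 ℚ./ suc n

-- The largest of 0, δ, 2δ, …, kδ whose square is at most q (or 0 if there is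
-- none).

sqrtBelow : ℚ → ℚ → ℕ → ℚ
sqrtBelow δ q zero    = 0ℚ
sqrtBelow δ q (suc k) =
  if ⌊ (ℕ→ℚ (suc k) ℚ.* δ) ℚ.* (ℕ→ℚ (suc k) ℚ.* δ) ℚ.≤? q ⌋
  then ℕ→ℚ (suc k) ℚ.* δ
  else sqrtBelow δ q k

-- For q ≥ 0 this is √q rounded down to a multiple of δ = 1/(n+1): the search
-- bound k is such that kδ = ∣ ↥ q ∣ + 1 > √q.

sqrtℚ : ℕ → ℚ → ℚ
sqrtℚ n q = sqrtBelow (1/suc n) q (suc ℤ.∣ ℚ.↥ q ∣ ℕ.* suc n)

toℚᵘ-ℕ→ℚ : ∀ n → ℚ.toℚᵘ (ℕ→ℚ n) ℚᵘ.≃ mkℚᵘ (+ n) 0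
toℚᵘ-ℕ→ℚ n = ℚ.toℚᵘ-fromℚᵘ (mkℚᵘ (+ n) 0)

ℕ→ℚ-+ : ∀ m n → ℕ→ℚ (m ℕ.+ n) ≡ ℕ→ℚ m ℚ.+ ℕ→ℚ n
ℕ→ℚ-+ m n = ℚ.toℚᵘ-injective (ℚᵘ.≃-trans (toℚᵘ-ℕ→ℚ (m ℕ.+ n))
  (ℚᵘ.≃-trans
    (*≡* (cong (ℤ._* + 1) (sym (cong₂ ℤ._+_ (ℤ.*-identityʳ (+ m)) (ℤ.*-identityʳ (+ n))))))
    (ℚᵘ.≃-sym (ℚᵘ.≃-trans (ℚ.toℚᵘ-homo-+ (ℕ→ℚ m) (ℕ→ℚ n))
      (ℚᵘ.+-cong (toℚᵘ-ℕ→ℚ m) (toℚᵘ-ℕ→ℚ n))))))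

ℕ→ℚ-* : ∀ m n → ℕ→ℚ (m ℕ.* n) ≡ ℕ→ℚ m ℚ.* ℕ→ℚ n
ℕ→ℚ-* m n = ℚ.toℚᵘ-injective (ℚᵘ.≃-trans (toℚᵘ-ℕ→ℚ (m ℕ.* n))
  (ℚᵘ.≃-trans
    (*≡* (cong (ℤ._* + 1) (ℤ.pos-* m n)))
    (ℚᵘ.≃-sym (ℚᵘ.≃-trans (ℚ.toℚᵘ-homo-* (ℕ→ℚ m) (ℕ→ℚ n))
      (ℚᵘ.*-cong (toℚᵘ-ℕ→ℚ m) (toℚᵘ-ℕ→ℚ n))))))

0≤ℕ→ℚ : ∀ n → 0ℚ ℚ.≤ ℕ→ℚ n
0≤ℕ→ℚ n = ℚ.nonNegative⁻¹ (ℕ→ℚ n) {{ℚ.normalize-nonNeg n 1}}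

ℕ→ℚ-suc : ∀ n → ℕ→ℚ (suc n) ≡ 1ℚ ℚ.+ ℕ→ℚ n
ℕ→ℚ-suc n = ℕ→ℚ-+ 1 n

0<1/suc : ∀ n → 0ℚ ℚ.< 1/suc n
0<1/suc n = ℚ.positive⁻¹ (1/suc n) {{ℚ.normalize-pos 1 (suc n)}}

suc*1/suc : ∀ n → ℕ→ℚ (suc n) ℚ.* 1/suc n ≡ 1ℚ
suc*1/suc n = ℚ.toℚᵘ-injective
  (ℚᵘ.≃-trans (ℚ.toℚᵘ-homo-* (ℕ→ℚ (suc n)) (1/suc n))
  (ℚᵘ.≃-trans (ℚᵘ.*-cong (toℚᵘ-ℕ→ℚ (suc n)) (ℚ.toℚᵘ-fromℚᵘ (mkℚᵘ (+ 1) n)))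
    (*≡* (trans (ℤ.*-identityʳ _) (trans (ℤ.*-identityʳ (+ suc n))
      (cong +_ (sym (trans (ℕ.*-identityˡ (1 ℕ.* suc n)) (ℕ.*-identityˡ (suc n))))))))))

q≤numerator : ∀ q → 0ℚ ℚ.≤ q → q ℚ.≤ ℕ→ℚ ℤ.∣ ℚ.↥ q ∣
q≤numerator q@(ℚ.mkℚ (+ n) d _) _ = ℚ.toℚᵘ-cancel-≤
  (ℚᵘ.≤-respʳ-≃ (ℚᵘ.≃-sym (toℚᵘ-ℕ→ℚ n))
    (ℚᵘ.*≤* (ℤ.*-monoˡ-≤-nonNeg (+ n) (ℤ.+≤+ (ℕ.s≤s ℕ.z≤n)))))
q≤numerator (ℚ.mkℚ (ℤ.-[1+ n ]) d _) (*≤* ())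

record Root (δ q r : ℚ) : Set where
  field
    0≤r  : 0ℚ ℚ.≤ r
    r²≤q : r ℚ.* r ℚ.≤ q
    q<   : q ℚ.< (r ℚ.+ δ) ℚ.* (r ℚ.+ δ)

step : ∀ k δ → ℕ→ℚ (suc k) ℚ.* δ ≡ ℕ→ℚ k ℚ.* δ ℚ.+ δ
step k δ = trans (cong (ℚ._* δ) (ℕ→ℚ-suc k))
  (solve 2 (λ a d → (con 1ℚ :+ a) :* d := a :* d :+ d) refl (ℕ→ℚ k) δ)

if-elim : ∀ {P : Set} (P? : Dec P) (Q : ℚ → Set) {x y} →
          (P → Q x) → (¬ P → Q y) → Q (if ⌊ P? ⌋ then x else y)
if-elim (yes p) Q f g = f p
if-elim (no ¬p) Q f g = g ¬p

sqrtBelow-root : ∀ δ q k → 0ℚ ℚ.≤ δ → 0ℚ ℚ.≤ q →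
  q ℚ.< (ℕ→ℚ k ℚ.* δ ℚ.+ δ) ℚ.* (ℕ→ℚ k ℚ.* δ ℚ.+ δ) →
  Root δ q (sqrtBelow δ q k)
sqrtBelow-root δ q zero 0≤δ 0≤q q< = record
  { 0≤r  = ℚ.≤-refl
  ; r²≤q = 0≤q
  ; q<   = subst (λ z → q ℚ.< (z ℚ.+ δ) ℚ.* (z ℚ.+ δ)) (ℚ.*-zeroˡ δ) q<
  }
sqrtBelow-root δ q (suc k) 0≤δ 0≤q q< =
  if-elim (r ℚ.* r ℚ.≤? q) (Root δ q)
    (λ p → record { 0≤r = 0≤* (0≤ℕ→ℚ (suc k)) 0≤δ ; r²≤q = p ; q<   = q< })
    (λ ¬p → sqrtBelow-root δ q k 0≤δ 0≤q
      (subst (λ z → q ℚ.< z ℚ.* z) (step k δ) (ℚ.≰⇒> ¬p)))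
  where
  r = ℕ→ℚ (suc k) ℚ.* δ

sqrtℚ-root : ∀ n q → 0ℚ ℚ.≤ q → Root (1/suc n) q (sqrtℚ n q)
sqrtℚ-root n q 0≤q = sqrtBelow-root δ q k (ℚ.<⇒≤ 0<δ) 0≤q
  (ℚ.<-≤-trans q<a (ℚ.≤-trans a≤a²
    (*-mono-≤ 0≤a 0≤a a≤ a≤)))
  where
  δ = 1/suc n
  0<δ = 0<1/suc n
  p = ℤ.∣ ℚ.↥ q ∣
  k = suc p ℕ.* suc n
  a = ℕ→ℚ (suc p)
  0≤a = 0≤ℕ→ℚ (suc p)
  1+p≡a : 1ℚ ℚ.+ ℕ→ℚ p ≡ a
  1+p≡a = sym (ℕ→ℚ-suc p)
  q<a : q ℚ.< a
  q<a = subst (q ℚ.<_) 1+p≡a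
    (subst (ℚ._< 1ℚ ℚ.+ ℕ→ℚ p) (ℚ.+-identityˡ q)
      (ℚ.+-mono-<-≤ 0<1 (q≤numerator q 0≤q)))
  1≤a : 1ℚ ℚ.≤ a
  1≤a = subst (1ℚ ℚ.≤_) 1+p≡a (ℚ.+-monoʳ-≤ 1ℚ (0≤ℕ→ℚ p))
  a≤a² : a ℚ.≤ a ℚ.* a
  a≤a² = subst (ℚ._≤ a ℚ.* a) (ℚ.*-identityˡ a)
    (*-mono-≤ 0≤1 0≤a 1≤a ℚ.≤-refl)
  kδ≡a : ℕ→ℚ k ℚ.* δ ≡ a
  kδ≡a = trans (cong (ℚ._* δ) (ℕ→ℚ-* (suc p) (suc n)))
    (trans (ℚ.*-assoc a (ℕ→ℚ (suc n)) δ)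
    (trans (cong (a ℚ.*_) (suc*1/suc n)) (ℚ.*-identityʳ a)))
  a≤ : a ℚ.≤ ℕ→ℚ k ℚ.* δ ℚ.+ δ
  a≤ = subst (λ z → a ℚ.≤ z ℚ.+ δ) (sym kδ≡a)
    (subst (ℚ._≤ a ℚ.+ δ) (ℚ.+-identityʳ a) (ℚ.+-monoʳ-≤ a (ℚ.<⇒≤ 0<δ)))

root-< : ∀ {δ δ′ q q′ r r′ ε} → 0ℚ ℚ.< ε → 0ℚ ℚ.≤ δ′ → δ′ ℚ.≤ ½ ℚ.* ε →
  Root δ q r → Root δ′ q′ r′ →
  q ℚ.< q′ ℚ.+ (½ ℚ.* ε) ℚ.* (½ ℚ.* ε) → r ℚ.< r′ ℚ.+ ε
root-< {δ} {δ′} {q} {q′} {r} {r′} {ε} 0<ε 0≤δ′ δ′≤ R R′ q<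
  with r ℚ.<? r′ ℚ.+ ε
... | yes p = p
... | no ¬p = contradiction chain (ℚ.<-irrefl refl)
  where
  module R  = Root R
  module R′ = Root R′
  e = ½ ℚ.* ε
  0≤e : 0ℚ ℚ.≤ e
  0≤e = ℚ.<⇒≤ (0<* 0<½ 0<ε)
  t = r′ ℚ.+ δ′
  0≤t : 0ℚ ℚ.≤ t
  0≤t = ℚ.+-mono-≤ R′.0≤r 0≤δ′
  t+e≤r : t ℚ.+ e ℚ.≤ r
  t+e≤r = ℚ.≤-trans
    (subst (t ℚ.+ e ℚ.≤_)
      (trans (ℚ.+-assoc r′ e e) (cong (r′ ℚ.+_) (half+half ε)))
      (ℚ.+-monoˡ-≤ e (ℚ.+-monoʳ-≤ r′ δ′≤)))
    (ℚ.≮⇒≥ ¬p)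
  t²+e²≤ : t ℚ.* t ℚ.+ e ℚ.* e ℚ.≤ (t ℚ.+ e) ℚ.* (t ℚ.+ e)
  t²+e²≤ = 0≤q-p⇒p≤q (subst (0ℚ ℚ.≤_)
    (solve 2 (λ t e → t :* e :+ t :* e := (t :+ e) :* (t :+ e) :- (t :* t :+ e :* e))
      refl t e)
    (ℚ.+-mono-≤ (0≤* 0≤t 0≤e) (0≤* 0≤t 0≤e)))
  0≤t+e = ℚ.+-mono-≤ 0≤t 0≤e
  chain : q ℚ.< q
  chain = ℚ.<-≤-trans q< (ℚ.≤-trans (ℚ.+-monoˡ-≤ (e ℚ.* e) (ℚ.<⇒≤ R′.q<))
    (ℚ.≤-trans t²+e²≤ (ℚ.≤-trans (*-mono-≤ 0≤t+e 0≤t+e t+e≤r t+e≤r) R.r²≤q)))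

1/suc-small : ∀ ε → 0ℚ ℚ.< ε → Eventually λ n → 1/suc n ℚ.≤ ε
1/suc-small ε 0<ε with divide 0<1 0<ε
... | r , 0<r , εr≡1 = N , bound
  where
  N = ℤ.∣ ℚ.↥ r ∣

  r≤ : ∀ n → N ℕ.≤ n → r ℚ.≤ ℕ→ℚ (suc n)
  r≤ n N≤n = ℚ.≤-trans (q≤numerator r (ℚ.<⇒≤ 0<r))
    (subst (λ z → ℕ→ℚ N ℚ.≤ ℕ→ℚ z) (ℕ.m+[n∸m]≡n (ℕ.m≤n⇒m≤1+n N≤n))
      (subst₂ ℚ._≤_ (ℚ.+-identityʳ (ℕ→ℚ N)) (sym (ℕ→ℚ-+ N (suc n ℕ.∸ N)))
        (ℚ.+-monoʳ-≤ (ℕ→ℚ N) (0≤ℕ→ℚ (suc n ℕ.∸ N)))))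

  bound : ∀ n → N ℕ.≤ n → 1/suc n ℚ.≤ ε
  bound n N≤n = subst₂ ℚ._≤_
    (trans (cong (ℚ._* 1/suc n) εr≡1) (ℚ.*-identityˡ (1/suc n)))
    (trans (ℚ.*-assoc ε (ℕ→ℚ (suc n)) (1/suc n))
      (trans (cong (ε ℚ.*_) (suc*1/suc n)) (ℚ.*-identityʳ ε)))
    (ℚ.*-monoʳ-≤-nonNeg (1/suc n) {{ℚ.nonNegative (ℚ.<⇒≤ (0<1/suc n))}}
      (ℚ.*-monoˡ-≤-nonNeg ε {{ℚ.nonNegative (ℚ.<⇒≤ 0<ε)}} (r≤ n N≤n)))

abstract
  √-cauchy : ∀ x → Cauchy x → Cauchy (λ n → sqrtℚ n (x n ℚ.⊔ 0ℚ))
  √-cauchy x cx ε 0<ε =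
    let 0<e = 0<* 0<½ 0<ε
        N , h      = ⊔-cauchy x (λ _ → 0ℚ) cx (cauchy 0ℝ) _ (0<* 0<e 0<e)
        N′ , small = 1/suc-small (½ ℚ.* ε) 0<e
    in N ℕ.⊔ N′ , λ m n p q →
      let pN = ℕ.m⊔n≤o⇒m≤o N N′ p ; pN′ = ℕ.m⊔n≤o⇒n≤o N N′ p
          qN = ℕ.m⊔n≤o⇒m≤o N N′ q ; qN′ = ℕ.m⊔n≤o⇒n≤o N N′ q
      in ∣p-q∣<-intro
        (root-< 0<ε (ℚ.<⇒≤ (0<1/suc n)) (small n qN′) (root m) (root n)
          (∣p-q∣<r⇒p<q+r (x m ℚ.⊔ 0ℚ) (x n ℚ.⊔ 0ℚ) (h m n pN qN)))
        (root-< 0<ε (ℚ.<⇒≤ (0<1/suc m)) (small m pN′) (root n) (root m)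
          (∣p-q∣<r⇒p<q+r (x n ℚ.⊔ 0ℚ) (x m ℚ.⊔ 0ℚ) (h n m qN pN)))
    where
    root : ∀ i → Root (1/suc i) (x i ℚ.⊔ 0ℚ) (sqrtℚ i (x i ℚ.⊔ 0ℚ))
    root i = sqrtℚ-root i (x i ℚ.⊔ 0ℚ) (ℚ.p≤q⊔p (x i) 0ℚ)

-- The square root of the positive part of x.

√_ : ℝ → ℝ
√ x = mkℝ (λ n → sqrtℚ n (seq x n ℚ.⊔ 0ℚ)) (√-cauchy (seq x) (cauchy x))

infix 8 √_

------------------------------------------------------------------------
-- Real matrices and γ₂

Matrix : ℕ → ℕ → Set
Matrix m n = Fin m → Fin n → ℝ

sum : ∀ {n} → (Fin n → ℝ) → ℝ
sum = foldr _+_ 0ℝ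

-- All the numbers maximised below are norms, so starting from 0 only matters
-- for the maximum of the empty family.

max : ∀ {n} → (Fin n → ℝ) → ℝ
max = foldr _⊔_ 0ℝ

infixl 7 _·_
infix 4 _≋_ _≤γ₂_ _γ₂≤_

_·_ : ∀ {m k n} → Matrix m k → Matrix k n → Matrix m n
(U · V) i j = sum λ l → U i l * V l j

_≋_ : ∀ {m n} → Matrix m n → Matrix m n → Set
A ≋ B = ∀ i j → A i j ≈ B i j

‖_‖₂ : ∀ {n} → (Fin n → ℝ) → ℝ
‖ v ‖₂ = √ (sum λ l → v l * v l)

‖_‖row : ∀ {m n} → Matrix m n → ℝ
‖ U ‖row = max λ i → ‖ U i ‖₂

‖_‖col : ∀ {m n} → Matrix m n → ℝ
‖ V ‖col = max λ j → ‖ (λ i → V i j) ‖₂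

record Factorization {m n} (A : Matrix m n) : Set where
  field
    k  : ℕ
    U  : Matrix m k
    V  : Matrix k n
    UV : U · V ≋ A

  value : ℝ
  value = ‖ U ‖row * ‖ V ‖col

open Factorization public using (value)

-- γ₂ A is the minimum of value over all factorizations of A (with arbitrary
-- inner dimension).  That it is attained is a classical compactness argument,
-- so γ₂ A is not available here as a function into ℝ.  Instead t ≤ γ₂ A and
-- γ₂ A ≤ t are defined as what they say about the minimum; ≤γ₂⇔ and γ₂≤⇔ check
-- that they agree with comparison to the number γ₂ A whenever one is given.

_≤γ₂_ : ∀ {m n} → ℝ → Matrix m n → Set
t ≤γ₂ A = (F : Factorization A) → t ≤ value F

_γ₂≤_ : ∀ {m n} → Matrix m n → ℝ → Set
A γ₂≤ t = Σ[ F ∈ Factorization A ] value F ≤ t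

Isγ₂ : ∀ {m n} → Matrix m n → ℝ → Set
Isγ₂ A g = (Σ[ F ∈ Factorization A ] value F ≈ g)
         × ((F : Factorization A) → g ≤ value F)

private
  ≤-trans : ∀ {x y z} → x ≤ y → y ≤ z → x ≤ z
  ≤-trans {x} {y} {z} p q = mk≤ λ ε 0<ε →
    let N , h   = below p (½ ℚ.* ε) (0<* 0<½ 0<ε)
        N′ , h′ = below q (½ ℚ.* ε) (0<* 0<½ 0<ε)
    in N ℕ.⊔ N′ , λ n l → ℚ.≤-trans (h n (ℕ.m⊔n≤o⇒m≤o N N′ l))
      (subst (seq y n ℚ.+ ½ ℚ.* ε ℚ.≤_)
        (trans (ℚ.+-assoc (seq z n) (½ ℚ.* ε) (½ ℚ.* ε))
               (cong (seq z n ℚ.+_) (half+half ε)))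
        (ℚ.+-monoˡ-≤ (½ ℚ.* ε) (h′ n (ℕ.m⊔n≤o⇒n≤o N N′ l))))

  ≈⇒≤ : ∀ {x y} → x ≈ y → x ≤ y
  ≈⇒≤ {x} {y} p = mk≤ λ ε 0<ε →
    let N , h = close p ε 0<ε
    in N , λ n l → ℚ.<⇒≤ (∣p-q∣<r⇒p<q+r (seq x n) (seq y n) (h n l))

≤γ₂⇔ : ∀ {m n} {A : Matrix m n} {g t} → Isγ₂ A g → (t ≤γ₂ A) ⇔ (t ≤ g)
≤γ₂⇔ ((F , F≈g) , g≤) = mk⇔
  (λ h → ≤-trans (h F) (≈⇒≤ F≈g))
  (λ t≤g F′ → ≤-trans t≤g (g≤ F′))

γ₂≤⇔ : ∀ {m n} {A : Matrix m n} {g t} → Isγ₂ A g → (A γ₂≤ t) ⇔ (g ≤ t)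
γ₂≤⇔ ((F , F≈g) , g≤) = mk⇔
  (λ (F′ , h) → ≤-trans (g≤ F′) h)
  (λ g≤t → F , ≤-trans (≈⇒≤ F≈g) g≤t)

------------------------------------------------------------------------
-- Boolean matrices

BoolMatrix : ℕ → ℕ → Set
BoolMatrix m n = Fin m → Fin n → Bool

toReal : ∀ {m n} → BoolMatrix m n → Matrix m n
toReal M i j = if M i j then 1ℝ else 0ℝ

FourCycleFree : ∀ {m n} → BoolMatrix m n → Set
FourCycleFree M = ∀ {i i′ j j′} → i ≢ i′ → j ≢ j′ →
  ¬ (M i j ≡ true × M i j′ ≡ true × M i′ j ≡ true × M i′ j′ ≡ true)

-- The number of ones of row i (column j) within the submatrix I × J.

rowOnes : ∀ {m n} → BoolMatrix m n → Subset n → Fin m → ℕ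
rowOnes M J i = ∣ J ∩ tabulate (M i) ∣

colOnes : ∀ {m n} → BoolMatrix m n → Subset m → Fin n → ℕ
colOnes M I j = ∣ I ∩ tabulate (λ i → M i j) ∣

-- Submatrices must have a row and a column: the one without either would
-- violate the condition for every d, and one lacking only rows or only columns
-- satisfies it trivially.

Degenerate : ∀ {m n} → BoolMatrix m n → ℕ → Set
Degenerate {m} {n} M d = (I : Subset m) (J : Subset n) → Nonempty I → Nonempty J →
    (∃[ i ] i ∈ I × rowOnes M J i ℕ.≤ d)
  ⊎ (∃[ j ] j ∈ J × colOnes M I j ℕ.≤ d)

HasDegeneracy : ∀ {m n} → BoolMatrix m n → ℕ → Set
HasDegeneracy M d = Degenerate M d × (∀ d′ → Degenerate M d′ → d ℕ.≤ d′)

{-# OPTIONS --safe #-}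
module Submission where

-- Upper bound: deleting sparse rows and columns one at a time splits M into a
-- matrix with at most d ones per row and one with at most d ones per column.
--
-- Lower bound: a dense submatrix N has at least d ones in each row and column; by
-- symmetry let it have at least as many rows as columns.  Weight row i by
-- p i = 1 / (its number of ones), let r l be the weighted number of ones of column
-- l, and put A = diag r + Nᵀ diag(p) N.  The dual witness is
-- Q = diag(p) N A⁻¹ diag(r).  As a regularised polar factor it has bounded norm
-- between the weighted spaces, whatever the degrees are.  Since N has no four-cycle,
-- Nᵀ diag(p) N is diagonal up to an error that is small in weighted Hilbert–Schmidt
-- norm, which makes ⟨Q , N⟩ at least a constant times the number of rows.

-- The operations of ℚ match on eta-expanded records, so they unfold on
-- variables; the opaque copies used here keep terms small and unification
-- working.

module Rational where

  open import Algebra.Bundles using (CommutativeRing)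
  open import Algebra.Structures using (IsCommutativeRing)
  open import Algebra.Solver.Ring.AlmostCommutativeRing
    using (fromCommutativeRing; _-Raw-AlmostCommutative⟶_)
  import Algebra.Solver.Ring as Solver
  open import Data.Fin.Base using (Fin; zero; suc)
  import Data.Integer.Base as ℤ
  open import Data.Nat.Base as ℕ using (ℕ; zero; suc)
  open import Data.Product using (∃-syntax; _×_; _,_; proj₁; proj₂)
  open import Data.Rational.Base as ℚ using (ℚ; 0ℚ; 1ℚ; ½; _≤_; _<_) public
  open import Data.Rational.Properties as ℚ
    using (≤-refl; ≤-trans; ≤-reflexive; <⇒≤; <-≤-trans; ≤-total)
  open import Data.Sum using (inj₁; inj₂)
  open import Function.Base using (id)
  open import Relation.Binary.PropositionalEquality
    using (_≡_; _≢_; refl; sym; trans; cong; cong₂; subst; subst₂; module ≡-Reasoning)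
  open import Relation.Nullary using (yes; no; contradiction)
  open import Relation.Nullary.Decidable using (dec⇒maybe)

  infixl 6 _+_ _-_
  infixl 7 _*_
  infix  8 -_

  opaque
    _+_ _*_ : ℚ → ℚ → ℚ
    _+_ = ℚ._+_
    _*_ = ℚ._*_

    -_ : ℚ → ℚ
    -_ = ℚ.-_

  _-_ : ℚ → ℚ → ℚ
  p - q = p + - q

  opaque
    unfolding _+_

    isCommutativeRing : IsCommutativeRing _≡_ _+_ _*_ -_ 0ℚ 1ℚ
    isCommutativeRing = ℚ.+-*-isCommutativeRing

    +-mono-≤ : ∀ {p q r s} → p ≤ q → r ≤ s → p + r ≤ q + s
    +-mono-≤ = ℚ.+-mono-≤

    +-mono-<-≤ : ∀ {p q r s} → p < q → r ≤ s → p + r < q + s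
    +-mono-<-≤ = ℚ.+-mono-<-≤

    neg-antimono-≤ : ∀ {p q} → p ≤ q → - q ≤ - p
    neg-antimono-≤ = ℚ.neg-antimono-≤

    *-monoˡ : ∀ {p q} r → 0ℚ ≤ r → p ≤ q → r * p ≤ r * q
    *-monoˡ r 0≤r = ℚ.*-monoˡ-≤-nonNeg r {{ℚ.nonNegative 0≤r}}

    *-monoˡ-< : ∀ {p q} r → 0ℚ < r → p < q → r * p < r * q
    *-monoˡ-< r 0<r = ℚ.*-monoʳ-<-pos r {{ℚ.positive 0<r}}

    *-cancelˡ : ∀ {p q} r → 0ℚ < r → r * p ≤ r * q → p ≤ q
    *-cancelˡ r 0<r = ℚ.*-cancelˡ-≤-pos r {{ℚ.positive 0<r}}

    inverse : ∀ {q} → 0ℚ < q → ∃[ r ] 0ℚ < r × q * r ≡ 1ℚ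
    inverse {q} 0<q = ℚ.1/ q , ℚ.positive⁻¹ (ℚ.1/ q) {{ℚ.1/pos⇒pos q}} , ℚ.*-inverseʳ q
      where
      instance
        q>0 : ℚ.Positive q
        q>0 = ℚ.positive 0<q
        q≢0 : ℚ.NonZero q
        q≢0 = ℚ.pos⇒nonZero q

  ring : CommutativeRing _ _
  ring = record { isCommutativeRing = isCommutativeRing }

  open CommutativeRing ring
    using (+-identityˡ; +-identityʳ; +-assoc; +-comm; *-identityˡ; *-identityʳ; *-assoc;
           *-comm; zeroˡ; zeroʳ; distribʳ; semiring) public
  open import Algebra.Properties.Semiring.Sum semiring public
    using (sum; sum-cong-≗; ∑-distrib-+; ∑-comm; *-distribˡ-sum; *-distribʳ-sum)
    renaming (sum-replicate-zero to sum-zero)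

  opaque
    unfolding _+_

    +-homo : ∀ p q → p ℚ.+ q ≡ p + q
    +-homo p q = refl

    *-homo : ∀ p q → p ℚ.* q ≡ p * q
    *-homo p q = refl

    neg-homo : ∀ p → ℚ.- p ≡ - p
    neg-homo p = refl

  constants : ℚ.+-*-rawRing -Raw-AlmostCommutative⟶ fromCommutativeRing ring
  constants = record
    { ⟦_⟧ = id ; +-homo = +-homo ; *-homo = *-homo ; -‿homo = neg-homo
    ; 0-homo = refl ; 1-homo = refl }

  open Solver ℚ.+-*-rawRing (fromCommutativeRing ring) constants
    (λ p q → dec⇒maybe (p ℚ.≟ q))
    using (solve; _:=_; _:+_; _:*_; _:-_; :-_; con) public

  2ℚ 3ℚ 4ℚ 9ℚ ⅛ 7/8 ¼ 1/3 2/3 4/3 1/9 4/9 5/9 : ℚ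
  2ℚ  = ℤ.+ 2 ℚ./ 1
  3ℚ  = ℤ.+ 3 ℚ./ 1
  4ℚ  = ℤ.+ 4 ℚ./ 1
  9ℚ  = ℤ.+ 9 ℚ./ 1
  7/8 = ℤ.+ 7 ℚ./ 8
  ⅛   = ℤ.+ 1 ℚ./ 8
  ¼   = ℤ.+ 1 ℚ./ 4
  1/3 = ℤ.+ 1 ℚ./ 3
  2/3 = ℤ.+ 2 ℚ./ 3
  4/3 = ℤ.+ 4 ℚ./ 3
  1/9 = ℤ.+ 1 ℚ./ 9
  4/9 = ℤ.+ 4 ℚ./ 9
  5/9 = ℤ.+ 5 ℚ./ 9

  0≤½ : 0ℚ ≤ ½
  0≤½ = ℚ.nonNegative⁻¹ ½

  0<1/9 : 0ℚ < 1/9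
  0<1/9 = ℚ.positive⁻¹ 1/9

  0≤1/9 : 0ℚ ≤ 1/9
  0≤1/9 = <⇒≤ 0<1/9

  0≤⅛ : 0ℚ ≤ ⅛
  0≤⅛ = ℚ.nonNegative⁻¹ ⅛

  0≤7/8 : 0ℚ ≤ 7/8
  0≤7/8 = ℚ.nonNegative⁻¹ 7/8

  0≤3 : 0ℚ ≤ 3ℚ
  0≤3 = ℚ.nonNegative⁻¹ 3ℚ

  0≤4 : 0ℚ ≤ 4ℚ
  0≤4 = ℚ.nonNegative⁻¹ 4ℚ

  0≤9 : 0ℚ ≤ 9ℚ
  0≤9 = ℚ.nonNegative⁻¹ 9ℚ

  0≤2 : 0ℚ ≤ 2ℚ
  0≤2 = ℚ.nonNegative⁻¹ 2ℚ

  p≤q⇒0≤q-p : ∀ {p q} → p ≤ q → 0ℚ ≤ q - p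
  p≤q⇒0≤q-p {p} {q} p≤q = subst (_≤ q - p) (solve 1 (λ p → p :- p := con 0ℚ) refl p)
    (+-mono-≤ p≤q (≤-refl { - p}))

  0≤q-p⇒p≤q : ∀ {p q} → 0ℚ ≤ q - p → p ≤ q
  0≤q-p⇒p≤q {p} {q} h = subst₂ _≤_ (+-identityˡ p)
    (solve 2 (λ q p → (q :- p) :+ p := q) refl q p) (+-mono-≤ h (≤-refl {p}))

  0≤1 : 0ℚ ≤ 1ℚ
  0≤1 = ℚ.nonNegative⁻¹ 1ℚ

  0<1 : 0ℚ < 1ℚ
  0<1 = ℚ.positive⁻¹ 1ℚ

  0≤+ : ∀ {p q} → 0ℚ ≤ p → 0ℚ ≤ q → 0ℚ ≤ p + q
  0≤+ {p} {q} 0≤p 0≤q = subst (_≤ p + q) (+-identityˡ 0ℚ) (+-mono-≤ 0≤p 0≤q)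

  0≤* : ∀ {p q} → 0ℚ ≤ p → 0ℚ ≤ q → 0ℚ ≤ p * q
  0≤* {p} {q} 0≤p 0≤q = subst (_≤ p * q) (zeroʳ p) (*-monoˡ p 0≤p 0≤q)

  0<+ : ∀ {p q} → 0ℚ < p → 0ℚ ≤ q → 0ℚ < p + q
  0<+ {p} {q} 0<p 0≤q = subst (_< p + q) (+-identityˡ 0ℚ) (+-mono-<-≤ 0<p 0≤q)

  0<* : ∀ {p q} → 0ℚ < p → 0ℚ < q → 0ℚ < p * q
  0<* {p} {q} 0<p 0<q = subst (_< p * q) (zeroʳ p) (*-monoˡ-< p 0<p 0<q)

  0≤-p : ∀ {p} → p ≤ 0ℚ → 0ℚ ≤ - p
  0≤-p {p} p≤0 = subst (_≤ - p) (solve 0 (:- con 0ℚ := con 0ℚ) refl) (neg-antimono-≤ p≤0)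

  0≤p² : ∀ p → 0ℚ ≤ p * p
  0≤p² p with ≤-total 0ℚ p
  ... | inj₁ 0≤p = 0≤* 0≤p 0≤p
  ... | inj₂ p≤0 = subst (0ℚ ≤_) (solve 1 (λ p → (:- p) :* (:- p) := p :* p) refl p)
    (0≤* (0≤-p p≤0) (0≤-p p≤0))

  *-monoʳ : ∀ {p q} r → 0ℚ ≤ r → p ≤ q → p * r ≤ q * r
  *-monoʳ {p} {q} r 0≤r p≤q = subst₂ _≤_ (*-comm r p) (*-comm r q) (*-monoˡ r 0≤r p≤q)

  *-mono : ∀ {p q r s} → 0ℚ ≤ p → 0ℚ ≤ r → p ≤ q → r ≤ s → p * r ≤ q * s
  *-mono {p} {q} {r} {s} 0≤p 0≤r p≤q r≤s =
    ≤-trans (*-monoˡ p 0≤p r≤s) (*-monoʳ s (≤-trans 0≤r r≤s) p≤q)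

  sum-mono : ∀ {n} {f g : Fin n → ℚ} → (∀ i → f i ≤ g i) → sum f ≤ sum g
  sum-mono {zero}  f≤g = ≤-refl
  sum-mono {suc n} f≤g = +-mono-≤ (f≤g zero) (sum-mono (λ i → f≤g (suc i)))

  0≤sum : ∀ {n} {f : Fin n → ℚ} → (∀ i → 0ℚ ≤ f i) → 0ℚ ≤ sum f
  0≤sum {n} {f} 0≤f = subst (_≤ sum f) (sum-zero n) (sum-mono 0≤f)

  term≤sum : ∀ {n} {f : Fin n → ℚ} → (∀ i → 0ℚ ≤ f i) → ∀ i → f i ≤ sum f
  term≤sum {f = f} 0≤f zero    = subst (_≤ sum f) (+-identityʳ _)
    (+-mono-≤ ≤-refl (0≤sum (λ i → 0≤f (suc i))))
  term≤sum {f = f} 0≤f (suc i) = subst (_≤ sum f) (+-identityˡ _)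
    (+-mono-≤ (0≤f zero) (term≤sum (λ i → 0≤f (suc i)) i))

  infix 8 _∙_

  _∙_ : ∀ {n} → (Fin n → ℚ) → (Fin n → ℚ) → ℚ
  f ∙ g = sum λ l → f l * g l

  ∙-comm : ∀ {n} (f g : Fin n → ℚ) → f ∙ g ≡ g ∙ f
  ∙-comm f g = sum-cong-≗ λ l → *-comm (f l) (g l)

  ∙-linear : ∀ {n} (f g h : Fin n → ℚ) s → f ∙ (λ l → g l - s * h l) ≡ f ∙ g - s * (f ∙ h)
  ∙-linear f g h s = begin
    f ∙ (λ l → g l - s * h l)
      ≡⟨ sum-cong-≗ (λ l → solve 4 (λ f g h s →
           f :* (g :- s :* h) := f :* g :+ (:- s) :* (f :* h)) refl (f l) (g l) (h l) s) ⟩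
    sum (λ l → f l * g l + (- s) * (f l * h l))
      ≡⟨ ∑-distrib-+ (λ l → f l * g l) _ ⟩
    f ∙ g + sum (λ l → (- s) * (f l * h l))
      ≡⟨ cong (f ∙ g +_) (sym (*-distribˡ-sum (- s) (λ l → f l * h l))) ⟩
    f ∙ g + (- s) * (f ∙ h)
      ≡⟨ solve 3 (λ a s b → a :+ (:- s) :* b := a :- s :* b) refl (f ∙ g) s (f ∙ h) ⟩
    f ∙ g - s * (f ∙ h) ∎
    where
    open ≡-Reasoning

  ridge : ∀ {m n} → (Fin n → ℚ) → (Fin m → ℚ) → (Fin m → Fin n → ℚ) →
          (Fin n → ℚ) → Fin n → ℚ
  ridge r p N g l = r l * g l + sum λ i → (p i * N i ∙ g) * N i l

  ridge-∙ : ∀ {m n} (r : Fin n → ℚ) (p : Fin m → ℚ) (N : Fin m → Fin n → ℚ) g h →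
    ridge r p N g ∙ h ≡
      sum (λ l → r l * (g l * h l)) + sum (λ i → p i * (N i ∙ g * N i ∙ h))
  ridge-∙ r p N g h = begin
    ridge r p N g ∙ h
      ≡⟨ sum-cong-≗ (λ l → trans (distribʳ (h l) (r l * g l) _)
           (cong₂ _+_ (*-assoc (r l) (g l) (h l))
             (*-distribʳ-sum (h l) (λ i → (p i * N i ∙ g) * N i l)))) ⟩
    sum (λ l → r l * (g l * h l) + sum (λ i → ((p i * N i ∙ g) * N i l) * h l))
      ≡⟨ ∑-distrib-+ (λ l → r l * (g l * h l)) _ ⟩
    sum (λ l → r l * (g l * h l)) + sum (λ l → sum (λ i → ((p i * N i ∙ g) * N i l) * h l))
      ≡⟨ cong (sum (λ l → r l * (g l * h l)) +_) (begin
           sum (λ l → sum (λ i → ((p i * N i ∙ g) * N i l) * h l))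
             ≡⟨ ∑-comm (λ l i → ((p i * N i ∙ g) * N i l) * h l) ⟩
           sum (λ i → sum (λ l → ((p i * N i ∙ g) * N i l) * h l))
             ≡⟨ sum-cong-≗ (λ i → trans
                  (sum-cong-≗ (λ l → *-assoc (p i * N i ∙ g) (N i l) (h l)))
                  (trans (sym (*-distribˡ-sum (p i * N i ∙ g) (λ l → N i l * h l)))
                    (*-assoc (p i) (N i ∙ g) (N i ∙ h)))) ⟩
           sum (λ i → p i * (N i ∙ g * N i ∙ h)) ∎) ⟩
    sum (λ l → r l * (g l * h l)) + sum (λ i → p i * (N i ∙ g * N i ∙ h)) ∎
    where open ≡-Reasoning

  ridge-selfadjoint : ∀ {m n} (r : Fin n → ℚ) (p : Fin m → ℚ) (N : Fin m → Fin n → ℚ) g h →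
    ridge r p N g ∙ h ≡ ridge r p N h ∙ g
  ridge-selfadjoint r p N g h = trans (ridge-∙ r p N g h) (trans
    (cong₂ _+_ (sum-cong-≗ (λ l → cong (r l *_) (*-comm (g l) (h l))))
               (sum-cong-≗ (λ i → cong (p i *_) (*-comm (N i ∙ g) (N i ∙ h)))))
    (sym (ridge-∙ r p N h g)))

  ridge-nonneg : ∀ {m n} (r : Fin n → ℚ) (p : Fin m → ℚ) (N : Fin m → Fin n → ℚ) →
    (∀ l → 0ℚ ≤ r l) → (∀ i → 0ℚ ≤ p i) → ∀ g → 0ℚ ≤ ridge r p N g ∙ g
  ridge-nonneg r p N 0≤r 0≤p g = subst (0ℚ ≤_) (sym (ridge-∙ r p N g g))
    (0≤+ (0≤sum (λ l → 0≤* (0≤r l) (0≤p² (g l))))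
         (0≤sum (λ i → 0≤* (0≤p i) (0≤p² (N i ∙ g)))))

  -- Adding one row to N is a rank-one update, solved by the Sherman–Morrison
  -- formula.

  ridge-solve : ∀ {m n} (r : Fin n → ℚ) (p : Fin m → ℚ) (N : Fin m → Fin n → ℚ) →
    (∀ l → 0ℚ < r l) → (∀ i → 0ℚ ≤ p i) →
    (b : Fin n → ℚ) → ∃[ g ] ∀ l → ridge r p N g l ≡ b l
  ridge-solve {zero} r p N 0<r 0≤p b =
    (λ l → proj₁ (inverse (0<r l)) * b l) , λ l →
      trans (+-identityʳ _) (trans (sym (*-assoc (r l) (proj₁ (inverse (0<r l))) (b l)))
        (trans (cong (_* b l) (proj₂ (proj₂ (inverse (0<r l))))) (*-identityˡ (b l))))
  ridge-solve {suc m} {n} r p N 0<r 0≤p b = g , eq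
    where
    p′ : Fin m → ℚ
    p′ i = p (suc i)
    N′ : Fin m → Fin n → ℚ
    N′ i = N (suc i)
    q = p zero
    x = N zero
    IH = ridge-solve r p′ N′ 0<r (λ i → 0≤p (suc i))
    h = proj₁ (IH b)
    y = proj₁ (IH x)
    0≤xy : 0ℚ ≤ x ∙ y
    0≤xy = subst (0ℚ ≤_) (sum-cong-≗ (λ l → cong (_* y l) (proj₂ (IH x) l)))
      (ridge-nonneg r p′ N′ (λ l → <⇒≤ (0<r l)) (λ i → 0≤p (suc i)) y)
    0<den : 0ℚ < 1ℚ + q * x ∙ y
    0<den = 0<+ 0<1 (0≤* (0≤p zero) 0≤xy)
    t = proj₁ (inverse 0<den)
    s = t * (q * x ∙ h)
    s-eq : q * (x ∙ h - s * x ∙ y) ≡ s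
    s-eq = begin
      q * (x ∙ h - s * x ∙ y)
        ≡⟨ solve 4 (λ q xh s xy → q :* (xh :- s :* xy)
             := (q :* xh :- (con 1ℚ :+ q :* xy) :* s) :+ s) refl q (x ∙ h) s (x ∙ y) ⟩
      (q * x ∙ h - (1ℚ + q * x ∙ y) * s) + s
        ≡⟨ cong (λ z → (q * x ∙ h - z) + s) (trans (sym (*-assoc (1ℚ + q * x ∙ y) t _))
             (trans (cong (_* (q * x ∙ h)) (proj₂ (proj₂ (inverse 0<den)))) (*-identityˡ _))) ⟩
      (q * x ∙ h - q * x ∙ h) + s
        ≡⟨ solve 2 (λ a s → (a :- a) :+ s := s) refl (q * x ∙ h) s ⟩
      s ∎
      where open ≡-Reasoning
    g : Fin n → ℚ
    g l = h l - s * y l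
    linear : ∀ l → ridge r p′ N′ g l ≡ ridge r p′ N′ h l - s * ridge r p′ N′ y l
    linear l = begin
      r l * g l + sum (λ i → (p′ i * N′ i ∙ g) * N′ i l)
        ≡⟨ cong (r l * g l +_) (sum-cong-≗ λ i →
             trans (cong (λ z → (p′ i * z) * N′ i l) (∙-linear (N′ i) h y s))
               (solve 5 (λ p a s b c → (p :* (a :- s :* b)) :* c
                   := c :* (p :* a) :- s :* (c :* (p :* b)))
                 refl (p′ i) (N′ i ∙ h) s (N′ i ∙ y) (N′ i l))) ⟩
      r l * g l + sum (λ i → N′ i l * (p′ i * N′ i ∙ h) - s * (N′ i l * (p′ i * N′ i ∙ y)))
        ≡⟨ cong (r l * g l +_) (begin
             sum (λ i → N′ i l * (p′ i * N′ i ∙ h) - s * (N′ i l * (p′ i * N′ i ∙ y)))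
               ≡⟨ sum-cong-≗ (λ i → sym (*-identityˡ
                    (N′ i l * (p′ i * N′ i ∙ h) - s * (N′ i l * (p′ i * N′ i ∙ y))))) ⟩
             (λ _ → 1ℚ) ∙ (λ i → N′ i l * (p′ i * N′ i ∙ h) - s * (N′ i l * (p′ i * N′ i ∙ y)))
               ≡⟨ ∙-linear (λ _ → 1ℚ) (λ i → N′ i l * (p′ i * N′ i ∙ h))
                    (λ i → N′ i l * (p′ i * N′ i ∙ y)) s ⟩
             (λ _ → 1ℚ) ∙ (λ i → N′ i l * (p′ i * N′ i ∙ h))
               - s * (λ _ → 1ℚ) ∙ (λ i → N′ i l * (p′ i * N′ i ∙ y))
               ≡⟨ cong₂ (λ a b → a - s * b)
                    (sum-cong-≗ (λ i → trans (*-identityˡ _) (*-comm (N′ i l) _)))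
                    (sum-cong-≗ (λ i → trans (*-identityˡ _) (*-comm (N′ i l) _))) ⟩
             H - s * Y ∎) ⟩
      r l * (h l - s * y l) + (H - s * Y)
        ≡⟨ solve 6 (λ r h s y H Y → r :* (h :- s :* y) :+ (H :- s :* Y)
             := (r :* h :+ H) :- s :* (r :* y :+ Y)) refl (r l) (h l) s (y l) H Y ⟩
      (r l * h l + H) - s * (r l * y l + Y) ∎
      where
      open ≡-Reasoning
      H = sum (λ i → (p′ i * N′ i ∙ h) * N′ i l)
      Y = sum (λ i → (p′ i * N′ i ∙ y) * N′ i l)
    eq : ∀ l → ridge r p N g l ≡ b l
    eq l = begin
      r l * g l + ((q * x ∙ g) * x l + sum (λ i → (p′ i * N′ i ∙ g) * N′ i l))
        ≡⟨ solve 3 (λ a b c → a :+ (b :+ c) := (a :+ c) :+ b) refl (r l * g l)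
             ((q * x ∙ g) * x l) (sum (λ i → (p′ i * N′ i ∙ g) * N′ i l)) ⟩
      ridge r p′ N′ g l + (q * x ∙ g) * x l
        ≡⟨ cong₂ _+_
             (trans (linear l) (cong₂ (λ a c → a - s * c) (proj₂ (IH b) l) (proj₂ (IH x) l)))
             (cong (_* x l) (trans (cong (q *_) (∙-linear x h y s)) s-eq)) ⟩
      (b l - s * x l) + s * x l
        ≡⟨ solve 2 (λ b a → (b :- a) :+ a := b) refl (b l) (s * x l) ⟩
      b l ∎
      where open ≡-Reasoning

  sum-linear : ∀ {n} a b (f g : Fin n → ℚ) →
    sum (λ l → a * f l + b * g l) ≡ a * sum f + b * sum g
  sum-linear a b f g = trans (∑-distrib-+ (λ l → a * f l) (λ l → b * g l))
    (sym (cong₂ _+_ (*-distribˡ-sum a f) (*-distribˡ-sum b g)))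

  0<sum⇒∃ : ∀ {n} (f : Fin n → ℚ) → 0ℚ < sum f → ∃[ i ] 0ℚ < f i
  0<sum⇒∃ {zero}  f 0<S = contradiction 0<S (ℚ.<-irrefl refl)
  0<sum⇒∃ {suc n} f 0<S with 0ℚ ℚ.<? f zero
  ... | yes 0<f = zero , 0<f
  ... | no  0≮f =
    let i , 0<fi = 0<sum⇒∃ (λ i → f (suc i)) (<-≤-trans 0<S
          (subst (f zero + sum (λ i → f (suc i)) ≤_) (+-identityˡ (sum (λ i → f (suc i))))
            (+-mono-≤ (ℚ.≮⇒≥ 0≮f) ≤-refl)))
    in suc i , 0<fi

  sum-disjoint-² : ∀ {m} (t : Fin m → ℚ) → (∀ {i i′} → i ≢ i′ → t i * t i′ ≡ 0ℚ) →
    sum t * sum t ≡ sum (λ i → t i * t i)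
  sum-disjoint-² {zero}  t disj = zeroˡ 0ℚ
  sum-disjoint-² {suc m} t disj = begin
    (t₀ + S) * (t₀ + S)
      ≡⟨ solve 2 (λ a b → (a :+ b) :* (a :+ b) := (a :* a :+ b :* b) :+ con 2ℚ :* (a :* b))
           refl t₀ S ⟩
    (t₀ * t₀ + S * S) + 2ℚ * (t₀ * S)
      ≡⟨ cong₂ (λ a b → (t₀ * t₀ + a) + 2ℚ * b)
           (sum-disjoint-² (λ i → t (suc i)) (λ i≢ → disj (λ { refl → i≢ refl })))
           (trans (*-distribˡ-sum t₀ (λ i → t (suc i)))
             (trans (sum-cong-≗ {n = m} (λ i → disj {zero} {suc i} (λ ()))) (sum-zero m))) ⟩
    (t₀ * t₀ + sum (λ i → t (suc i) * t (suc i))) + 2ℚ * 0ℚ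
      ≡⟨ solve 2 (λ a b → (a :+ b) :+ con 2ℚ :* con 0ℚ := a :+ b) refl (t₀ * t₀) _ ⟩
    t₀ * t₀ + sum (λ i → t (suc i) * t (suc i)) ∎
    where
    open ≡-Reasoning
    t₀ = t zero
    S = sum (λ i → t (suc i))

  δ : ∀ {n} → Fin n → Fin n → ℚ
  δ zero    zero    = 1ℚ
  δ zero    (suc l) = 0ℚ
  δ (suc j) zero    = 0ℚ
  δ (suc j) (suc l) = δ j l

  δ-cases : ∀ {n} (P : Fin n → ℚ → Set) j → P j 1ℚ → (∀ l → j ≢ l → P l 0ℚ) → ∀ l → P l (δ j l)
  δ-cases P zero    p₁ p₀ zero    = p₁
  δ-cases P zero    p₁ p₀ (suc l) = p₀ (suc l) (λ ())
  δ-cases P (suc j) p₁ p₀ zero    = p₀ zero (λ ())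
  δ-cases P (suc j) p₁ p₀ (suc l) =
    δ-cases (λ l → P (suc l)) j p₁ (λ l j≢l → p₀ (suc l) (λ { refl → j≢l refl })) l

  δ-refl : ∀ {n} (j : Fin n) → δ j j ≡ 1ℚ
  δ-refl zero    = refl
  δ-refl (suc j) = δ-refl j

  δ-∙ : ∀ {n} j (x : Fin n → ℚ) → δ j ∙ x ≡ x j
  δ-∙ {suc n} zero x = trans (cong₂ _+_ (*-identityˡ (x zero))
    (trans (sum-cong-≗ {n = n} (λ l → zeroˡ (x (suc l)))) (sum-zero n))) (+-identityʳ (x zero))
  δ-∙ (suc j) x = trans (cong₂ _+_ (zeroˡ (x zero)) (δ-∙ j (λ l → x (suc l))))
    (+-identityˡ (x (suc j)))

  module Certificate {m n : ℕ} (N : Fin m → Fin n → ℚ)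
    (N²≡N : ∀ i j → N i j * N i j ≡ N i j)
    (C₄-free : ∀ {i i′ j l} → i ≢ i′ → j ≢ l → (N i j * N i l) * (N i′ j * N i′ l) ≡ 0ℚ)
    (0<row : ∀ i → 0ℚ < sum (N i))
    (0<column : ∀ j → 0ℚ < sum (λ i → N i j))
    where

    0≤N : ∀ i j → 0ℚ ≤ N i j
    0≤N i j = subst (0ℚ ≤_) (N²≡N i j) (0≤p² (N i j))

    p : Fin m → ℚ
    p i = proj₁ (inverse (0<row i))

    0<p : ∀ i → 0ℚ < p i
    0<p i = proj₁ (proj₂ (inverse (0<row i)))

    0≤p : ∀ i → 0ℚ ≤ p i
    0≤p i = <⇒≤ (0<p i)

    row*p : ∀ i → sum (N i) * p i ≡ 1ℚ
    row*p i = proj₂ (proj₂ (inverse (0<row i)))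

    r : Fin n → ℚ
    r l = sum λ i → p i * N i l

    0<r : ∀ l → 0ℚ < r l
    0<r l =
      let i , 0<N = 0<sum⇒∃ (λ i → N i l) (0<column l)
      in <-≤-trans (0<* (0<p i) 0<N) (term≤sum (λ i → 0≤* (0≤p i) (0≤N i l)) i)

    w : Fin n → ℚ
    w l = proj₁ (inverse (0<r l))

    0≤w : ∀ l → 0ℚ ≤ w l
    0≤w l = <⇒≤ (proj₁ (proj₂ (inverse (0<r l))))

    r*w : ∀ l → r l * w l ≡ 1ℚ
    r*w l = proj₂ (proj₂ (inverse (0<r l)))

    A : (Fin n → ℚ) → Fin n → ℚ
    A = ridge r p N

    A⁻¹ : (Fin n → ℚ) → Fin n → ℚ
    A⁻¹ b = proj₁ (ridge-solve r p N 0<r 0≤p b)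

    A-A⁻¹ : ∀ b l → A (A⁻¹ b) l ≡ b l
    A-A⁻¹ b = proj₂ (ridge-solve r p N 0<r 0≤p b)

    A⁻¹-selfadjoint : ∀ b b′ → b ∙ A⁻¹ b′ ≡ b′ ∙ A⁻¹ b
    A⁻¹-selfadjoint b b′ = begin
      b ∙ A⁻¹ b′            ≡⟨ sum-cong-≗ (λ l → cong (_* A⁻¹ b′ l) (sym (A-A⁻¹ b l))) ⟩
      A (A⁻¹ b) ∙ A⁻¹ b′    ≡⟨ ridge-selfadjoint r p N (A⁻¹ b) (A⁻¹ b′) ⟩
      A (A⁻¹ b′) ∙ A⁻¹ b    ≡⟨ sum-cong-≗ (λ l → cong (_* A⁻¹ b l) (A-A⁻¹ b′ l)) ⟩
      b′ ∙ A⁻¹ b            ∎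
      where open ≡-Reasoning

    energy : ∀ b → sum (λ l → r l * (A⁻¹ b l * A⁻¹ b l))
                   + sum (λ i → p i * (N i ∙ A⁻¹ b * N i ∙ A⁻¹ b)) ≡ b ∙ A⁻¹ b
    energy b = trans (sym (ridge-∙ r p N (A⁻¹ b) (A⁻¹ b)))
      (sum-cong-≗ (λ l → cong (_* A⁻¹ b l) (A-A⁻¹ b l)))

    Q : Fin m → Fin n → ℚ
    Q i j = p i * (r j * A⁻¹ (N i) j)

    Q-bound : (u : Fin m → ℚ) (v : Fin n → ℚ) → sum (λ i → sum (λ j → Q i j * (u i * v j)))
      ≤ ½ * sum (λ i → p i * (u i * u i)) + ⅛ * sum (λ l → r l * (v l * v l))
    Q-bound u v = begin
      sum (λ i → sum (λ j → Q i j * (u i * v j)))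
        ≡⟨ sum-cong-≗ row ⟩
      sum (λ i → p i * (u i * f i))
        ≤⟨ sum-mono (λ i → 0≤q-p⇒p≤q (subst (0ℚ ≤_)
             (solve 3 (λ p u f → con ½ :* (p :* ((u :- f) :* (u :- f)))
               := (con ½ :* (p :* (u :* u)) :+ con ½ :* (p :* (f :* f))) :- p :* (u :* f))
               refl (p i) (u i) (f i))
             (0≤* 0≤½ (0≤* (0≤p i) (0≤p² (u i - f i)))))) ⟩
      sum (λ i → ½ * (p i * (u i * u i)) + ½ * (p i * (f i * f i)))
        ≡⟨ sum-linear ½ ½ (λ i → p i * (u i * u i)) (λ i → p i * (f i * f i)) ⟩
      ½ * sum (λ i → p i * (u i * u i)) + ½ * F
        ≤⟨ +-mono-≤ ≤-refl (*-monoˡ ½ 0≤½ F≤) ⟩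
      ½ * sum (λ i → p i * (u i * u i)) + ½ * (¼ * V)
        ≡⟨ solve 2 (λ a b → a :+ con ½ :* (con ¼ :* b) := a :+ con ⅛ :* b) refl _ V ⟩
      ½ * sum (λ i → p i * (u i * u i)) + ⅛ * V ∎
      where
      open ℚ.≤-Reasoning
      rv : Fin n → ℚ
      rv l = r l * v l
      g = A⁻¹ rv
      f : Fin m → ℚ
      f i = N i ∙ g
      F = sum (λ i → p i * (f i * f i))
      V = sum (λ l → r l * (v l * v l))
      row : ∀ i → sum (λ j → Q i j * (u i * v j)) ≡ p i * (u i * f i)
      row i = let y = A⁻¹ (N i) in begin-equality
        sum (λ j → Q i j * (u i * v j))
          ≡⟨ sum-cong-≗ (λ j → solve 5 (λ p r y u v →
               (p :* (r :* y)) :* (u :* v) := (p :* u) :* ((r :* v) :* y))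
               refl (p i) (r j) (y j) (u i) (v j)) ⟩
        sum (λ j → (p i * u i) * (rv j * y j))
          ≡⟨ sym (*-distribˡ-sum (p i * u i) (λ j → rv j * y j)) ⟩
        (p i * u i) * (rv ∙ y)
          ≡⟨ cong ((p i * u i) *_) (A⁻¹-selfadjoint rv (N i)) ⟩
        (p i * u i) * f i
          ≡⟨ *-assoc (p i) (u i) (f i) ⟩
        p i * (u i * f i) ∎
      G = sum (λ l → r l * (g l * g l))
      G+F≤ : G + F ≤ ¼ * V + 1ℚ * G
      G+F≤ = begin
        G + F     ≡⟨ energy rv ⟩
        rv ∙ g    ≤⟨ sum-mono (λ l → 0≤q-p⇒p≤q (subst (0ℚ ≤_)
                       (solve 3 (λ r v g →
                          r :* ((con ½ :* v :- g) :* (con ½ :* v :- g))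
                          := (con ¼ :* (r :* (v :* v)) :+ con 1ℚ :* (r :* (g :* g)))
                             :- (r :* v) :* g) refl (r l) (v l) (g l))
                       (0≤* (<⇒≤ (0<r l)) (0≤p² (½ * v l - g l))))) ⟩
        sum (λ l → ¼ * (r l * (v l * v l)) + 1ℚ * (r l * (g l * g l)))
                  ≡⟨ sum-linear ¼ 1ℚ (λ l → r l * (v l * v l)) (λ l → r l * (g l * g l)) ⟩
        ¼ * V + 1ℚ * G ∎
      F≤ : F ≤ ¼ * V
      F≤ = subst₂ _≤_ (solve 2 (λ a b → (a :+ b) :- a := b) refl G F)
        (solve 2 (λ a b → (b :+ con 1ℚ :* a) :- a := b) refl G (¼ * V))
        (+-mono-≤ G+F≤ (≤-refl { - G}))

    codegree : Fin n → Fin n → ℚ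
    codegree j l = sum λ i → p i * (N i j * N i l)

    off : Fin n → Fin n → ℚ
    off j l = codegree j l - r l * δ j l

    off-same : ∀ j → codegree j j - r j * 1ℚ ≡ 0ℚ
    off-same j = trans (cong (_- r j * 1ℚ) (sum-cong-≗ (λ i → cong (p i *_) (N²≡N i j))))
      (solve 1 (λ a → a :- a :* con 1ℚ := con 0ℚ) refl (r j))

    off-diff : ∀ j l → codegree j l - r l * 0ℚ ≡ codegree j l
    off-diff j l = solve 2 (λ c a → c :- a :* con 0ℚ := c) refl (codegree j l) (r l)

    off² : ∀ j l → off j l * off j l ≤ sum λ i → (p i * p i) * (N i j * N i l)
    off² j = δ-cases
      (λ l d → (codegree j l - r l * d) * (codegree j l - r l * d)
               ≤ sum λ i → (p i * p i) * (N i j * N i l)) j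
      (subst (_≤ sum λ i → (p i * p i) * (N i j * N i j))
        (sym (trans (cong (λ z → z * z) (off-same j)) (zeroˡ 0ℚ)))
        (0≤sum λ i → 0≤* (0≤p² (p i)) (0≤* (0≤N i j) (0≤N i j))))
      (λ l j≢l → ≤-reflexive (trans (cong (λ z → z * z) (off-diff j l))
        (trans (sum-disjoint-² (λ i → p i * (N i j * N i l)) (λ {i} {i′} i≢i′ →
            trans (solve 4 (λ p p′ a b → (p :* a) :* (p′ :* b) := (p :* p′) :* (a :* b))
                     refl (p i) (p i′) (N i j * N i l) (N i′ j * N i′ l))
              (trans (cong ((p i * p i′) *_) (C₄-free i≢i′ j≢l)) (zeroʳ (p i * p i′)))))
          (sum-cong-≗ λ i → trans
            (solve 3 (λ p a b → (p :* (a :* b)) :* (p :* (a :* b))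
                := (p :* p) :* ((a :* a) :* (b :* b))) refl (p i) (N i j) (N i l))
            (cong₂ (λ a b → (p i * p i) * (a * b)) (N²≡N i j) (N²≡N i l))))))

    sum-off² : ∀ l → sum (λ j → off j l * off j l) ≤ r l
    sum-off² l = begin
      sum (λ j → off j l * off j l)
        ≤⟨ sum-mono (λ j → off² j l) ⟩
      sum (λ j → sum λ i → (p i * p i) * (N i j * N i l))
        ≡⟨ ∑-comm (λ j i → (p i * p i) * (N i j * N i l)) ⟩
      sum (λ i → sum λ j → (p i * p i) * (N i j * N i l))
        ≡⟨ sum-cong-≗ (λ i → begin-equality
             sum (λ j → (p i * p i) * (N i j * N i l))
               ≡⟨ sum-cong-≗ (λ j → solve 3 (λ p a b → (p :* p) :* (a :* b)
                    := ((p :* p) :* b) :* a) refl (p i) (N i j) (N i l)) ⟩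
             sum (λ j → ((p i * p i) * N i l) * N i j)
               ≡⟨ sym (*-distribˡ-sum ((p i * p i) * N i l) (N i)) ⟩
             ((p i * p i) * N i l) * sum (N i)
               ≡⟨ solve 3 (λ p b a → ((p :* p) :* b) :* a := (p :* b) :* (a :* p))
                    refl (p i) (N i l) (sum (N i)) ⟩
             (p i * N i l) * (sum (N i) * p i)
               ≡⟨ trans (cong ((p i * N i l) *_) (row*p i)) (*-identityʳ (p i * N i l)) ⟩
             p i * N i l ∎) ⟩
      r l ∎
      where open ℚ.≤-Reasoning

    sum-r : sum r ≡ sum {m} (λ _ → 1ℚ)
    sum-r = trans (∑-comm (λ l i → p i * N i l)) (sum-cong-≗ λ i →
      trans (sym (*-distribˡ-sum (p i) (N i))) (trans (*-comm (p i) (sum (N i))) (row*p i)))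

    column-correlation : ∀ j →
      4/9 * r j + (- 1/9) * sum (λ l → w l * (off j l * off j l)) ≤ sum (λ i → Q i j * N i j)
    column-correlation j = subst₂ _≤_
      (solve 3 (λ r O X → ((con 4/9 :* r :+ (:- con 1/9) :* O) :+ X) :- X
          := con 4/9 :* r :+ (:- con 1/9) :* O) refl (r j) O X)
      (sym correlation)
      (0≤q-p⇒p≤q (subst (0ℚ ≤_)
        (solve 3 (λ r O X → (con 5/9 :* r :+ con 1/9 :* O) :- X
          := (r :- X) :- (((con 4/9 :* r :+ (:- con 1/9) :* O) :+ X) :- X)) refl (r j) O X)
        (subst (_≤ (5/9 * r j + 1/9 * O) - X) (solve 1 (λ a → a :- a := con 0ℚ) refl X)
          (+-mono-≤ X≤ (≤-refl { - X})))))
      where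
      open ℚ.≤-Reasoning
      b : Fin n → ℚ
      b l = r l * δ j l
      k = A⁻¹ b
      f : Fin m → ℚ
      f i = N i ∙ k
      X = r j * k j
      O = sum (λ l → w l * (off j l * off j l))
      F = sum (λ i → p i * (f i * f i))
      R = sum (λ l → r l * (k l * k l))
      b∙ : ∀ x → b ∙ x ≡ r j * x j
      b∙ x = trans (sum-cong-≗ (λ l → solve 3 (λ r d x → (r :* d) :* x := d :* (r :* x))
        refl (r l) (δ j l) (x l))) (δ-∙ j (λ l → r l * x l))
      correlation : sum (λ i → Q i j * N i j) ≡ r j - X
      correlation = begin-equality
        sum (λ i → Q i j * N i j)
          ≡⟨ sum-cong-≗ (λ i → cong (λ z → (p i * z) * N i j)
               (trans (sym (b∙ (A⁻¹ (N i)))) (A⁻¹-selfadjoint b (N i)))) ⟩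
        S
          ≡⟨ solve 2 (λ S X → S := (X :+ S) :- X) refl S X ⟩
        A k j - X
          ≡⟨ cong (_- X) (A-A⁻¹ b j) ⟩
        b j - X
          ≡⟨ cong (λ z → z - X) bj≡ ⟩
        r j - X ∎
        where
        S = sum (λ i → (p i * f i) * N i j)
        bj≡ : r j * δ j j ≡ r j
        bj≡ = trans (cong (r j *_) (δ-refl j)) (*-identityʳ (r j))
      t₁ = sum (λ i → p i * (N i j * f i))
      t₃ = off j ∙ k
      t₁≡ : t₁ ≡ X + t₃
      t₁≡ = begin-equality
        t₁
          ≡⟨ sum-cong-≗ (λ i → trans (sym (*-assoc (p i) (N i j) (f i)))
               (*-distribˡ-sum (p i * N i j) (λ l → N i l * k l))) ⟩
        sum (λ i → sum (λ l → (p i * N i j) * (N i l * k l)))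
          ≡⟨ ∑-comm (λ i l → (p i * N i j) * (N i l * k l)) ⟩
        sum (λ l → sum (λ i → (p i * N i j) * (N i l * k l)))
          ≡⟨ sum-cong-≗ (λ l → begin-equality
               sum (λ i → (p i * N i j) * (N i l * k l))
                 ≡⟨ sum-cong-≗ (λ i → solve 4 (λ p a b k → (p :* a) :* (b :* k)
                      := (p :* (a :* b)) :* k) refl (p i) (N i j) (N i l) (k l)) ⟩
               sum (λ i → (p i * (N i j * N i l)) * k l)
                 ≡⟨ sym (*-distribʳ-sum (k l) (λ i → p i * (N i j * N i l))) ⟩
               codegree j l * k l
                 ≡⟨ solve 3 (λ c b k → c :* k := b :* k :+ (c :- b) :* k)
                      refl (codegree j l) (b l) (k l) ⟩
               b l * k l + off j l * k l ∎) ⟩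
        sum (λ l → b l * k l + off j l * k l)
          ≡⟨ ∑-distrib-+ (λ l → b l * k l) (λ l → off j l * k l) ⟩
        b ∙ k + t₃
          ≡⟨ cong (_+ t₃) (b∙ k) ⟩
        X + t₃ ∎
      I₁ : 2/3 * t₁ ≤ 1/9 * r j + 1ℚ * F
      I₁ = begin
        2/3 * t₁
          ≡⟨ *-distribˡ-sum 2/3 (λ i → p i * (N i j * f i)) ⟩
        sum (λ i → 2/3 * (p i * (N i j * f i)))
          ≤⟨ sum-mono (λ i → 0≤q-p⇒p≤q (subst (0ℚ ≤_)
               (trans (solve 3 (λ p a f → p :* ((con 1/3 :* a :- f) :* (con 1/3 :* a :- f))
                   := (con 1/9 :* (p :* (a :* a)) :+ con 1ℚ :* (p :* (f :* f)))
                      :- con 2/3 :* (p :* (a :* f))) refl (p i) (N i j) (f i))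
                 (cong (λ z → (1/9 * (p i * z) + 1ℚ * (p i * (f i * f i)))
                      - 2/3 * (p i * (N i j * f i))) (N²≡N i j)))
               (0≤* (0≤p i) (0≤p² (1/3 * N i j - f i))))) ⟩
        sum (λ i → 1/9 * (p i * N i j) + 1ℚ * (p i * (f i * f i)))
          ≡⟨ sum-linear 1/9 1ℚ (λ i → p i * N i j) (λ i → p i * (f i * f i)) ⟩
        1/9 * r j + 1ℚ * F ∎
      I₂ : 4/3 * X + (- 2/3) * t₃ ≤ 4/9 * r j + 1ℚ * (1/9 * O + 1ℚ * R)
      I₂ = begin
        4/3 * X + (- 2/3) * t₃
          ≡⟨ cong (λ z → 4/3 * z + (- 2/3) * t₃) (sym (b∙ k)) ⟩
        4/3 * (b ∙ k) + (- 2/3) * t₃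
          ≡⟨ sym (sum-linear 4/3 (- 2/3) (λ l → b l * k l) (λ l → off j l * k l)) ⟩
        sum (λ l → 4/3 * ((r l * δ j l) * k l)
                   + (- 2/3) * ((codegree j l - r l * δ j l) * k l))
          ≤⟨ sum-mono (δ-cases (λ l d → 4/3 * ((r l * d) * k l)
                   + (- 2/3) * ((codegree j l - r l * d) * k l)
                 ≤ 4/9 * (r l * d) + 1ℚ * (1/9 * (w l * ((codegree j l - r l * d)
                      * (codegree j l - r l * d))) + 1ℚ * (r l * (k l * k l)))) j
               on-diagonal off-diagonal) ⟩
        sum (λ l → 4/9 * b l + 1ℚ * (1/9 * (w l * (off j l * off j l)) + 1ℚ * (r l * (k l * k l))))
          ≡⟨ sum-linear 4/9 1ℚ b _ ⟩
        4/9 * sum b + 1ℚ * sum (λ l → 1/9 * (w l * (off j l * off j l)) + 1ℚ * (r l * (k l * k l)))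
          ≡⟨ cong₂ (λ x y → 4/9 * x + 1ℚ * y)
               (trans (sum-cong-≗ (λ l → *-comm (r l) (δ j l))) (δ-∙ j r))
               (sum-linear 1/9 1ℚ (λ l → w l * (off j l * off j l)) (λ l → r l * (k l * k l))) ⟩
        4/9 * r j + 1ℚ * (1/9 * O + 1ℚ * R) ∎
        where
        on-diagonal : 4/3 * ((r j * 1ℚ) * k j) + (- 2/3) * ((codegree j j - r j * 1ℚ) * k j)
          ≤ 4/9 * (r j * 1ℚ) + 1ℚ * (1/9 * (w j * ((codegree j j - r j * 1ℚ)
               * (codegree j j - r j * 1ℚ))) + 1ℚ * (r j * (k j * k j)))
        on-diagonal rewrite off-same j = 0≤q-p⇒p≤q (subst (0ℚ ≤_)
          (solve 3 (λ r k w → r :* ((con 2/3 :- k) :* (con 2/3 :- k))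
            := (con 4/9 :* (r :* con 1ℚ) :+ con 1ℚ :* (con 1/9 :* (w :* (con 0ℚ :* con 0ℚ))
                 :+ con 1ℚ :* (r :* (k :* k))))
               :- (con 4/3 :* ((r :* con 1ℚ) :* k) :+ (:- con 2/3) :* (con 0ℚ :* k)))
            refl (r j) (k j) (w j))
          (0≤* (<⇒≤ (0<r j)) (0≤p² (2/3 - k j))))
        off-diagonal : ∀ l → j ≢ l →
          4/3 * ((r l * 0ℚ) * k l) + (- 2/3) * ((codegree j l - r l * 0ℚ) * k l)
          ≤ 4/9 * (r l * 0ℚ) + 1ℚ * (1/9 * (w l * ((codegree j l - r l * 0ℚ)
               * (codegree j l - r l * 0ℚ))) + 1ℚ * (r l * (k l * k l)))
        off-diagonal l _ = 0≤q-p⇒p≤q (subst (0ℚ ≤_)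
          (trans (solve 4 (λ r k w c →
              w :* ((con 1/3 :* c :+ r :* k) :* (con 1/3 :* c :+ r :* k))
              := con 1/9 :* (w :* (c :* c)) :+ (r :* w) :* (con 2/3 :* (c :* k) :+ r :* (k :* k)))
              refl (r l) (k l) (w l) (codegree j l))
            (trans (cong (λ z → 1/9 * (w l * (codegree j l * codegree j l))
                + z * (2/3 * (codegree j l * k l) + r l * (k l * k l))) (r*w l))
              (solve 4 (λ r k w c →
                con 1/9 :* (w :* (c :* c)) :+ con 1ℚ :* (con 2/3 :* (c :* k) :+ r :* (k :* k))
                := (con 4/9 :* (r :* con 0ℚ) :+ con 1ℚ :* (con 1/9 :* (w :* ((c :- r :* con 0ℚ)
                     :* (c :- r :* con 0ℚ))) :+ con 1ℚ :* (r :* (k :* k))))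
                   :- (con 4/3 :* ((r :* con 0ℚ) :* k)
                       :+ (:- con 2/3) :* ((c :- r :* con 0ℚ) :* k)))
                refl (r l) (k l) (w l) (codegree j l))))
          (0≤* (0≤w l) (0≤p² (1/3 * codegree j l + r l * k l))))
      X≤ : X ≤ 5/9 * r j + 1/9 * O
      X≤ = begin
        X
          ≡⟨ solve 2 (λ X t → X :=
               (con 2/3 :* (X :+ t) :+ (con 4/3 :* X :+ (:- con 2/3) :* t)) :- X)
               refl X t₃ ⟩
        (2/3 * (X + t₃) + (4/3 * X + (- 2/3) * t₃)) - X
          ≡⟨ cong (λ z → (2/3 * z + (4/3 * X + (- 2/3) * t₃)) - X) (sym t₁≡) ⟩
        (2/3 * t₁ + (4/3 * X + (- 2/3) * t₃)) - X
          ≤⟨ +-mono-≤ (+-mono-≤ I₁ I₂) (≤-refl { - X}) ⟩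
        ((1/9 * r j + 1ℚ * F) + (4/9 * r j + 1ℚ * (1/9 * O + 1ℚ * R))) - X
          ≡⟨ cong (λ z → ((1/9 * r j + 1ℚ * F) + (4/9 * r j + 1ℚ * (1/9 * O + 1ℚ * R))) - z)
               (sym (trans (energy b) (b∙ k))) ⟩
        ((1/9 * r j + 1ℚ * F) + (4/9 * r j + 1ℚ * (1/9 * O + 1ℚ * R))) - (R + F)
          ≡⟨ solve 4 (λ r F O R → ((con 1/9 :* r :+ con 1ℚ :* F)
               :+ (con 4/9 :* r :+ con 1ℚ :* (con 1/9 :* O :+ con 1ℚ :* R))) :- (R :+ F)
               := con 5/9 :* r :+ con 1/9 :* O) refl (r j) F O R ⟩
        5/9 * r j + 1/9 * O ∎

    Q-correlation : 4/9 * sum {m} (λ _ → 1ℚ) + (- 1/9) * sum {n} (λ _ → 1ℚ)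
                    ≤ sum (λ i → sum (λ j → Q i j * N i j))
    Q-correlation = begin
      4/9 * sum {m} (λ _ → 1ℚ) + (- 1/9) * sum {n} (λ _ → 1ℚ)
        ≡⟨ cong (λ z → 4/9 * z + (- 1/9) * sum {n} (λ _ → 1ℚ)) (sym sum-r) ⟩
      4/9 * sum r + (- 1/9) * sum {n} (λ _ → 1ℚ)
        ≤⟨ +-mono-≤ ≤-refl (0≤q-p⇒p≤q (subst (0ℚ ≤_)
             (solve 2 (λ a b → con 1/9 :* (a :- b) := (:- con 1/9) :* b :- (:- con 1/9) :* a)
               refl (sum {n} (λ _ → 1ℚ)) (sum O))
             (0≤* 0≤1/9 (subst (_≤ sum {n} (λ _ → 1ℚ) - sum O)
               (solve 1 (λ a → a :- a := con 0ℚ) refl (sum O))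
               (+-mono-≤ sum-O (≤-refl { - sum O})))))) ⟩
      4/9 * sum r + (- 1/9) * sum O
        ≡⟨ sym (sum-linear 4/9 (- 1/9) r O) ⟩
      sum (λ j → 4/9 * r j + (- 1/9) * O j)
        ≤⟨ sum-mono column-correlation ⟩
      sum (λ j → sum (λ i → Q i j * N i j))
        ≡⟨ ∑-comm (λ j i → Q i j * N i j) ⟩
      sum (λ i → sum (λ j → Q i j * N i j)) ∎
      where
      open ℚ.≤-Reasoning
      O : Fin n → ℚ
      O j = sum (λ l → w l * (off j l * off j l))
      sum-O : sum O ≤ sum {n} (λ _ → 1ℚ)
      sum-O = begin
        sum O
          ≡⟨ ∑-comm (λ j l → w l * (off j l * off j l)) ⟩
        sum (λ l → sum (λ j → w l * (off j l * off j l)))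
          ≡⟨ sum-cong-≗ (λ l → sym (*-distribˡ-sum (w l) (λ j → off j l * off j l))) ⟩
        sum (λ l → w l * sum (λ j → off j l * off j l))
          ≤⟨ sum-mono (λ l → ≤-trans (*-monoˡ (w l) (0≤w l) (sum-off² l))
               (≤-reflexive (trans (*-comm (w l) (r l)) (r*w l)))) ⟩
        sum {n} (λ _ → 1ℚ) ∎

  Q-bound-rows : ∀ {m n k} (Q : Fin m → Fin n → ℚ) (p : Fin m → ℚ) (r : Fin n → ℚ) →
    (∀ (u : Fin m → ℚ) (v : Fin n → ℚ) → sum (λ i → sum (λ j → Q i j * (u i * v j)))
      ≤ ½ * sum (λ i → p i * (u i * u i)) + ⅛ * sum (λ l → r l * (v l * v l))) →
    ∀ s t (u : Fin m → Fin k → ℚ) (v : Fin n → Fin k → ℚ) →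
    (s * t) * sum (λ i → sum (λ j → Q i j * u i ∙ v j))
      ≤ ½ * ((s * s) * sum (λ i → p i * u i ∙ u i))
        + ⅛ * ((t * t) * sum (λ l → r l * v l ∙ v l))
  Q-bound-rows {m} {n} {k} Q p r bound s t u v = begin
    (s * t) * sum (λ i → sum (λ j → Q i j * u i ∙ v j))
      ≡⟨ *-distribˡ-sum (s * t) (λ i → sum (λ j → Q i j * u i ∙ v j)) ⟩
    sum (λ i → (s * t) * sum (λ j → Q i j * u i ∙ v j))
      ≡⟨ sum-cong-≗ (λ i → begin-equality
           (s * t) * sum (λ j → Q i j * u i ∙ v j)
             ≡⟨ *-distribˡ-sum (s * t) (λ j → Q i j * u i ∙ v j) ⟩
           sum (λ j → (s * t) * (Q i j * u i ∙ v j))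
             ≡⟨ sum-cong-≗ (λ j → trans (sym (*-assoc (s * t) (Q i j) (u i ∙ v j)))
                  (trans (*-distribˡ-sum ((s * t) * Q i j) (λ c → u i c * v j c))
                    (sum-cong-≗ λ c → solve 5 (λ s t q u v →
                      ((s :* t) :* q) :* (u :* v) := q :* ((s :* u) :* (t :* v)))
                      refl s t (Q i j) (u i c) (v j c)))) ⟩
           sum (λ j → sum (λ c → Q i j * ((s * u i c) * (t * v j c))))
             ≡⟨ ∑-comm (λ j c → Q i j * ((s * u i c) * (t * v j c))) ⟩
           sum (λ c → sum (λ j → Q i j * ((s * u i c) * (t * v j c)))) ∎) ⟩
    sum (λ i → sum (λ c → sum (λ j → Q i j * ((s * u i c) * (t * v j c)))))
      ≡⟨ ∑-comm (λ i c → sum (λ j → Q i j * ((s * u i c) * (t * v j c)))) ⟩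
    sum (λ c → sum (λ i → sum (λ j → Q i j * ((s * u i c) * (t * v j c)))))
      ≤⟨ sum-mono (λ c → bound (λ i → s * u i c) (λ j → t * v j c)) ⟩
    sum (λ c → ½ * sum (λ i → p i * ((s * u i c) * (s * u i c)))
               + ⅛ * sum (λ l → r l * ((t * v l c) * (t * v l c))))
      ≡⟨ sum-linear ½ ⅛ (λ c → sum (λ i → p i * ((s * u i c) * (s * u i c))))
           (λ c → sum (λ l → r l * ((t * v l c) * (t * v l c)))) ⟩
    ½ * sum (λ c → sum (λ i → p i * ((s * u i c) * (s * u i c))))
      + ⅛ * sum (λ c → sum (λ l → r l * ((t * v l c) * (t * v l c))))
      ≡⟨ cong₂ (λ a b → ½ * a + ⅛ * b) (collect s p u) (collect t r v) ⟩
    ½ * ((s * s) * sum (λ i → p i * u i ∙ u i))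
      + ⅛ * ((t * t) * sum (λ l → r l * v l ∙ v l)) ∎
    where
    open ℚ.≤-Reasoning
    collect : ∀ {m} s (p : Fin m → ℚ) (u : Fin m → Fin k → ℚ) →
      sum (λ c → sum (λ i → p i * ((s * u i c) * (s * u i c))))
        ≡ (s * s) * sum (λ i → p i * u i ∙ u i)
    collect s p u = begin-equality
      sum (λ c → sum (λ i → p i * ((s * u i c) * (s * u i c))))
        ≡⟨ ∑-comm (λ c i → p i * ((s * u i c) * (s * u i c))) ⟩
      sum (λ i → sum (λ c → p i * ((s * u i c) * (s * u i c))))
        ≡⟨ sum-cong-≗ (λ i → trans
             (sum-cong-≗ (λ c → solve 3 (λ s p u → p :* ((s :* u) :* (s :* u))
               := ((s :* s) :* p) :* (u :* u)) refl s (p i) (u i c)))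
             (trans (sym (*-distribˡ-sum ((s * s) * p i) (λ c → u i c * u i c)))
               (*-assoc (s * s) (p i) (u i ∙ u i)))) ⟩
      sum (λ i → (s * s) * (p i * u i ∙ u i))
        ≡⟨ sym (*-distribˡ-sum (s * s) (λ i → p i * u i ∙ u i)) ⟩
      (s * s) * sum (λ i → p i * u i ∙ u i) ∎

  *-error : ∀ q → ∃[ B ] 0ℚ ≤ B × (∀ x ε → - ε ≤ x → x ≤ ε → 0ℚ ≤ B * ε + q * x)
  *-error q with ≤-total 0ℚ q
  ... | inj₁ 0≤q = q , 0≤q , λ x ε lo hi → subst (0ℚ ≤_)
    (solve 3 (λ q x ε → q :* (x :- (:- ε)) := q :* ε :+ q :* x) refl q x ε)
    (0≤* 0≤q (p≤q⇒0≤q-p lo))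
  ... | inj₂ q≤0 = - q , 0≤-p q≤0 , λ x ε lo hi → subst (0ℚ ≤_)
    (solve 3 (λ q x ε → (:- q) :* (ε :- x) := (:- q) :* ε :+ q :* x) refl q x ε)
    (0≤* (0≤-p q≤0) (p≤q⇒0≤q-p hi))

  ones : ℕ → ℚ
  ones n = sum {n} (λ _ → 1ℚ)

  0≤ones : ∀ n → 0ℚ ≤ ones n
  0≤ones n = 0≤sum {n} (λ _ → 0≤1)

  ones-mono : ∀ {m n} → m ℕ.≤ n → ones m ≤ ones n
  ones-mono {n = n} ℕ.z≤n = 0≤ones n
  ones-mono (ℕ.s≤s m≤n) = +-mono-≤ ≤-refl (ones-mono m≤n)

  -- The error ε lets the bound be applied to the rational approximations of a real
  -- factorization.

  Robust : ∀ {m n} → (Fin m → Fin n → ℚ) → ℚ → Set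
  Robust {m} {n} N κ = ∃[ W ] 0ℚ ≤ W ×
    (∀ ε {k} (u : Fin m → Fin k → ℚ) (v : Fin n → Fin k → ℚ) α β →
      0ℚ ≤ ε → 0ℚ < α → 0ℚ < β →
      (∀ i → u i ∙ u i ≤ α * α) → (∀ j → v j ∙ v j ≤ β * β) →
      (∀ i j → - ε ≤ u i ∙ v j - N i j) → (∀ i j → u i ∙ v j - N i j ≤ ε) →
      κ ≤ 9ℚ * (α * β) + W * ε)

  Robust-transpose : ∀ {m n} {N : Fin m → Fin n → ℚ} {κ} →
    Robust (λ j i → N i j) κ → Robust N κ
  Robust-transpose {N = N} {κ} (W , 0≤W , bound) = W , 0≤W ,
    λ ε u v α β 0≤ε 0<α 0<β u≤ v≤ lo hi →
      subst (λ z → κ ≤ 9ℚ * z + W * ε) (*-comm β α)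
        (bound ε v u β α 0≤ε 0<β 0<α v≤ u≤
          (λ j i → subst (λ z → - ε ≤ z - N i j) (∙-comm (u i) (v j)) (lo i j))
          (λ j i → subst (λ z → z - N i j ≤ ε) (∙-comm (u i) (v j)) (hi i j)))

  Robust-restrict : ∀ {m n m′ n′} {N : Fin m → Fin n → ℚ} {κ}
    (φ : Fin m′ → Fin m) (ψ : Fin n′ → Fin n) →
    Robust (λ i j → N (φ i) (ψ j)) κ → Robust N κ
  Robust-restrict φ ψ (W , 0≤W , bound) = W , 0≤W ,
    λ ε u v α β 0≤ε 0<α 0<β u≤ v≤ lo hi →
      bound ε (λ i → u (φ i)) (λ j → v (ψ j)) α β 0≤ε 0<α 0<β
        (λ i → u≤ (φ i)) (λ j → v≤ (ψ j))
        (λ i j → lo (φ i) (ψ j)) (λ i j → hi (φ i) (ψ j))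

  C₄-free-robust : ∀ {m n} (N : Fin m → Fin n → ℚ) →
    (∀ i j → N i j * N i j ≡ N i j) →
    (∀ {i i′ j l} → i ≢ i′ → j ≢ l → (N i j * N i l) * (N i′ j * N i′ l) ≡ 0ℚ) →
    ∀ D κ → 0ℚ < D → 0ℚ ≤ κ → κ * κ ≤ 4ℚ * D →
    (∀ i → D ≤ sum (N i)) → (∀ j → 0ℚ < sum (λ i → N i j)) →
    n ℕ.≤ m → 0 ℕ.< m → Robust N κ
  C₄-free-robust {m} {n} N N²≡N C₄-free D κ 0<D 0≤κ κ²≤4D D≤row 0<column n≤m 0<m =
    W , 0≤* 0≤3 (0≤* 0≤κ 0≤B) , robust
    where
    open ℚ.≤-Reasoning
    open Certificate N N²≡N C₄-free (λ i → <-≤-trans 0<D (D≤row i)) 0<column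
    M = ones m
    b : Fin m → Fin n → ℚ
    b i j = proj₁ (*-error (Q i j))
    B = sum (λ i → sum (λ j → b i j))
    0≤B : 0ℚ ≤ B
    0≤B = 0≤sum (λ i → 0≤sum (λ j → proj₁ (proj₂ (*-error (Q i j)))))
    W = 3ℚ * (κ * B)
    1≤M : 1ℚ ≤ M
    1≤M = subst (_≤ M) (+-identityʳ 1ℚ) (ones-mono 0<m)
    κ²Σp≤ : (κ * κ) * sum p ≤ 4ℚ * M
    κ²Σp≤ = begin
      (κ * κ) * sum p          ≤⟨ *-monoʳ (sum p) (0≤sum 0≤p) κ²≤4D ⟩
      (4ℚ * D) * sum p         ≡⟨ *-assoc 4ℚ D (sum p) ⟩
      4ℚ * (D * sum p)         ≡⟨ cong (4ℚ *_) (*-distribˡ-sum D p) ⟩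
      4ℚ * sum (λ i → D * p i) ≤⟨ *-monoˡ 4ℚ 0≤4 (sum-mono λ i →
        ≤-trans (*-monoʳ (p i) (0≤p i) (D≤row i)) (≤-reflexive (row*p i))) ⟩
      4ℚ * M                   ∎
    correlation : 1/3 * M ≤ sum (λ i → sum (λ j → Q i j * N i j))
    correlation = ≤-trans (0≤q-p⇒p≤q (subst (0ℚ ≤_)
      (solve 2 (λ m n → con 1/9 :* (m :- n)
          := (con 4/9 :* m :+ (:- con 1/9) :* n) :- con 1/3 :* m) refl M (ones n))
      (0≤* 0≤1/9 (p≤q⇒0≤q-p (ones-mono n≤m))))) Q-correlation
    robust : ∀ ε {k} (u : Fin m → Fin k → ℚ) (v : Fin n → Fin k → ℚ) α β →
      0ℚ ≤ ε → 0ℚ < α → 0ℚ < β →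
      (∀ i → u i ∙ u i ≤ α * α) → (∀ j → v j ∙ v j ≤ β * β) →
      (∀ i j → - ε ≤ u i ∙ v j - N i j) → (∀ i j → u i ∙ v j - N i j ≤ ε) →
      κ ≤ 9ℚ * (α * β) + W * ε
    robust ε u v α β 0≤ε 0<α 0<β u≤ v≤ lo hi = *-cancelˡ M (<-≤-trans 0<1 1≤M) (begin
      M * κ
        ≡⟨ solve 2 (λ m k → m :* k := con 3ℚ :* (k :* (con 1/3 :* m))) refl M κ ⟩
      3ℚ * (κ * (1/3 * M))
        ≤⟨ *-monoˡ 3ℚ 0≤3 (*-monoˡ κ 0≤κ (≤-trans correlation T′≤)) ⟩
      3ℚ * (κ * (B * ε + T))
        ≡⟨ solve 4 (λ k b e t → con 3ℚ :* (k :* (b :* e :+ t))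
             := con 3ℚ :* (k :* t) :+ con 3ℚ :* (k :* b) :* e) refl κ B ε T ⟩
      3ℚ * (κ * T) + W * ε
        ≤⟨ +-mono-≤ (*-monoˡ 3ℚ 0≤3 κT≤) (0≤q-p⇒p≤q (subst (0ℚ ≤_)
             (solve 2 (λ m x → (m :- con 1ℚ) :* x := m :* x :- x) refl M (W * ε))
             (0≤* (p≤q⇒0≤q-p 1≤M) (0≤* (0≤* 0≤3 (0≤* 0≤κ 0≤B)) 0≤ε)))) ⟩
      3ℚ * (3ℚ * (M * (α * β))) + M * (W * ε)
        ≡⟨ solve 3 (λ m x y → con 3ℚ :* (con 3ℚ :* (m :* x)) :+ m :* y
             := m :* (con 9ℚ :* x :+ y)) refl M (α * β) (W * ε) ⟩
      M * (9ℚ * (α * β) + W * ε) ∎)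
      where
      T = sum (λ i → sum (λ j → Q i j * u i ∙ v j))
      T′≤ : sum (λ i → sum (λ j → Q i j * N i j)) ≤ B * ε + T
      T′≤ = begin
        sum (λ i → sum (λ j → Q i j * N i j))
          ≤⟨ sum-mono (λ i → sum-mono (λ j → 0≤q-p⇒p≤q (subst (0ℚ ≤_)
               (solve 5 (λ b ε q t a → b :* ε :+ q :* (t :- a)
                 := (ε :* b :+ con 1ℚ :* (q :* t)) :- q :* a)
                 refl (b i j) ε (Q i j) (u i ∙ v j) (N i j))
               (proj₂ (proj₂ (*-error (Q i j))) (u i ∙ v j - N i j) ε (lo i j) (hi i j))))) ⟩
        sum (λ i → sum (λ j → ε * b i j + 1ℚ * (Q i j * u i ∙ v j)))
          ≡⟨ sum-cong-≗ (λ i → sum-linear ε 1ℚ (b i) (λ j → Q i j * u i ∙ v j)) ⟩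
        sum (λ i → ε * sum (b i) + 1ℚ * sum (λ j → Q i j * u i ∙ v j))
          ≡⟨ sum-linear ε 1ℚ (λ i → sum (b i)) (λ i → sum (λ j → Q i j * u i ∙ v j)) ⟩
        ε * B + 1ℚ * T
          ≡⟨ cong₂ _+_ (*-comm ε B) (*-identityˡ T) ⟩
        B * ε + T ∎
      αβ = α * β
      κT≤ : κ * T ≤ 3ℚ * (M * αβ)
      κT≤ = *-cancelˡ αβ (0<* 0<α 0<β) (begin
        αβ * (κ * T)
          ≡⟨ solve 4 (λ a b k t → (a :* b) :* (k :* t) := ((b :* k) :* a) :* t) refl α β κ T ⟩
        ((β * κ) * α) * T
          ≤⟨ Q-bound-rows Q p r Q-bound (β * κ) α u v ⟩
        ½ * (((β * κ) * (β * κ)) * sum (λ i → p i * u i ∙ u i))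
          + ⅛ * ((α * α) * sum (λ l → r l * v l ∙ v l))
          ≤⟨ +-mono-≤
               (*-monoˡ ½ 0≤½ (*-monoˡ _ (0≤p² (β * κ)) (weighted p 0≤p u u≤)))
               (*-monoˡ ⅛ 0≤⅛ (*-monoˡ _ (0≤p² α) (weighted r (λ l → <⇒≤ (0<r l)) v v≤))) ⟩
        ½ * (((β * κ) * (β * κ)) * ((α * α) * sum p)) + ⅛ * ((α * α) * ((β * β) * sum r))
          ≡⟨ cong (λ z → ½ * (((β * κ) * (β * κ)) * ((α * α) * sum p))
               + ⅛ * ((α * α) * ((β * β) * z))) sum-r ⟩
        ½ * (((β * κ) * (β * κ)) * ((α * α) * sum p)) + ⅛ * ((α * α) * ((β * β) * M))
          ≡⟨ solve 5 (λ a b k P m →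
               con ½ :* (((b :* k) :* (b :* k)) :* ((a :* a) :* P))
                 :+ con ⅛ :* ((a :* a) :* ((b :* b) :* m))
               := ((a :* b) :* (a :* b)) :* (con ½ :* ((k :* k) :* P) :+ con ⅛ :* m))
               refl α β κ (sum p) M ⟩
        (αβ * αβ) * (½ * ((κ * κ) * sum p) + ⅛ * M)
          ≤⟨ *-monoˡ (αβ * αβ) (0≤p² αβ) (≤-trans
               (+-mono-≤ (*-monoˡ ½ 0≤½ κ²Σp≤) (≤-refl {⅛ * M}))
               (0≤q-p⇒p≤q (subst (0ℚ ≤_)
                 (solve 1 (λ m → con 7/8 :* m
                   := con 3ℚ :* m :- (con ½ :* (con 4ℚ :* m) :+ con ⅛ :* m)) refl M)
                 (0≤* 0≤7/8 (0≤ones m))))) ⟩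
        (αβ * αβ) * (3ℚ * M)
          ≡⟨ solve 2 (λ x m → (x :* x) :* (con 3ℚ :* m) := x :* (con 3ℚ :* (m :* x))) refl αβ M ⟩
        αβ * (3ℚ * (M * αβ)) ∎)
        where
        weighted : ∀ {m k x} (p : Fin m → ℚ) → (∀ i → 0ℚ ≤ p i) →
          (u : Fin m → Fin k → ℚ) → (∀ i → u i ∙ u i ≤ x) →
          sum (λ i → p i * u i ∙ u i) ≤ x * sum p
        weighted {x = x} p 0≤p u u≤ = ≤-trans (sum-mono (λ i → *-monoˡ (p i) (0≤p i) (u≤ i)))
          (≤-reflexive (trans (sum-cong-≗ (λ i → *-comm (p i) x)) (sym (*-distribˡ-sum x p))))

module Counting where

  open import Data.Bool.Base using (Bool; true; false; _∧_; not; if_then_else_)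
  import Data.Bool.Properties as Bool
  open import Data.Empty using (⊥-elim)
  open import Data.Fin.Base using (Fin; zero; suc; splitAt)
  import Data.Fin.Properties as Fin
  open import Data.Fin.Subset
    using (Subset; Nonempty; _∈_; _∩_; ∣_∣; inside; outside)
    renaming (_-_ to _─_; ⊤ to full)
  open import Data.Fin.Subset.Properties
    using (_∈?_; nonempty?; anySubset?; ∈⊤; x∈p⇒∣p-x∣<∣p∣; x∈p∧x≢y⇒x∈p-y)
  open import Data.Nat.Base as ℕ using (ℕ; zero; suc)
  import Data.Nat.Properties as ℕ
  open import Data.Nat.Solver using (module +-*-Solver)
  open import Data.Product using (∃-syntax; _×_; _,_; proj₁; proj₂)
  import Data.Rational.Properties as ℚ
  open import Data.Sum using (_⊎_; inj₁; inj₂)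
  open import Data.Vec.Base using (_∷_; []; lookup; tabulate; here; there)
  open import Data.Vec.Functional using (_++_)
  open import Data.Vec.Properties using ([]=⇒lookup; lookup⇒[]=)
  open import Defs
    using (ℕ→ℚ; ℕ→ℚ-+; ℕ→ℚ-*; ℕ→ℚ-suc; 0≤ℕ→ℚ; BoolMatrix; FourCycleFree; Degenerate;
           HasDegeneracy; rowOnes; colOnes)
  open import Function.Base using (_∘_)
  open import Relation.Binary.PropositionalEquality
  open import Relation.Nullary using (¬_; Dec; yes; no; contradiction; does)
  open import Relation.Nullary.Decidable using (_×-dec_; _→-dec_)
  open Rational

  𝟙 : Bool → ℚ
  𝟙 b = if b then 1ℚ else 0ℚ

  0≤𝟙 : ∀ b → 0ℚ ≤ 𝟙 b
  0≤𝟙 true  = 0≤1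
  0≤𝟙 false = ℚ.≤-refl

  𝟙² : ∀ b → 𝟙 b * 𝟙 b ≡ 𝟙 b
  𝟙² true  = *-identityˡ 1ℚ
  𝟙² false = zeroˡ 0ℚ

  suc-ℚ : ∀ n → ℕ→ℚ (suc n) ≡ 1ℚ + ℕ→ℚ n
  suc-ℚ n = trans (ℕ→ℚ-suc n) (+-homo 1ℚ (ℕ→ℚ n))

  ℕ→ℚ-mono : ∀ {m n} → m ℕ.≤ n → ℕ→ℚ m ≤ ℕ→ℚ n
  ℕ→ℚ-mono {m} {n} m≤n = subst (λ k → ℕ→ℚ m ≤ ℕ→ℚ k) (ℕ.m+[n∸m]≡n m≤n)
    (subst₂ _≤_ (+-identityʳ (ℕ→ℚ m))
      (sym (trans (ℕ→ℚ-+ m (n ℕ.∸ m)) (+-homo (ℕ→ℚ m) (ℕ→ℚ (n ℕ.∸ m)))))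
      (+-mono-≤ (ℚ.≤-refl {ℕ→ℚ m}) (0≤ℕ→ℚ (n ℕ.∸ m))))

  0<ℕ→ℚ-suc : ∀ n → 0ℚ < ℕ→ℚ (suc n)
  0<ℕ→ℚ-suc n = subst (0ℚ <_) (sym (suc-ℚ n)) (0<+ 0<1 (0≤ℕ→ℚ n))

  enum : ∀ {n} (S : Subset n) → Fin ∣ S ∣ → Fin n
  enum (inside  ∷ S) zero    = zero
  enum (inside  ∷ S) (suc i) = suc (enum S i)
  enum (outside ∷ S) i       = suc (enum S i)

  enum∈ : ∀ {n} (S : Subset n) i → enum S i ∈ S
  enum∈ (inside  ∷ S) zero    = here
  enum∈ (inside  ∷ S) (suc i) = there (enum∈ S i)
  enum∈ (outside ∷ S) i       = there (enum∈ S i)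

  enum-injective : ∀ {n} (S : Subset n) {i j} → enum S i ≡ enum S j → i ≡ j
  enum-injective (inside  ∷ S) {zero}  {zero}  eq = refl
  enum-injective (inside  ∷ S) {suc i} {suc j} eq =
    cong suc (enum-injective S (Fin.suc-injective eq))
  enum-injective (outside ∷ S) eq = enum-injective S (Fin.suc-injective eq)

  sum-enum : ∀ {n} (S : Subset n) (f : Fin n → Bool) →
    sum (λ i → 𝟙 (f (enum S i))) ≡ ℕ→ℚ ∣ S ∩ tabulate f ∣
  sum-enum []            f = refl
  sum-enum (inside  ∷ S) f with f zero
  ... | true  = trans (cong (1ℚ +_) (sum-enum S (f ∘ suc))) (sym (suc-ℚ ∣ S ∩ tabulate (f ∘ suc) ∣))
  ... | false = trans (+-identityˡ _) (sum-enum S (f ∘ suc))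
  sum-enum (outside ∷ S) f = sum-enum S (f ∘ suc)

  sum-mask : ∀ {n} (S : Subset n) (f : Fin n → Bool) →
    sum (λ i → 𝟙 (lookup S i ∧ f i)) ≡ ℕ→ℚ ∣ S ∩ tabulate f ∣
  sum-mask []            f = refl
  sum-mask (inside  ∷ S) f with f zero
  ... | true  = trans (cong (1ℚ +_) (sum-mask S (f ∘ suc))) (sym (suc-ℚ ∣ S ∩ tabulate (f ∘ suc) ∣))
  ... | false = trans (+-identityˡ _) (sum-mask S (f ∘ suc))
  sum-mask (outside ∷ S) f = trans (+-identityˡ _) (sum-mask S (f ∘ suc))

  0<∣S∣ : ∀ {n} {S : Subset n} → Nonempty S → 0 ℕ.< ∣ S ∣
  0<∣S∣ (x , x∈S) = ℕ.≤-<-trans ℕ.z≤n (x∈p⇒∣p-x∣<∣p∣ x∈S)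

  Dense : ∀ {m n} → BoolMatrix m n → ℕ → Subset m → Subset n → Set
  Dense M d I J = Nonempty I × Nonempty J
    × (∀ i → i ∈ I → d ℕ.≤ rowOnes M J i) × (∀ j → j ∈ J → d ℕ.≤ colOnes M I j)

  dense? : ∀ {m n} (M : BoolMatrix m n) d I J → Dec (Dense M d I J)
  dense? M d I J = nonempty? I ×-dec nonempty? J
    ×-dec Fin.all? (λ i → (i ∈? I) →-dec (d ℕ.≤? rowOnes M J i))
    ×-dec Fin.all? (λ j → (j ∈? J) →-dec (d ℕ.≤? colOnes M I j))

  degenerate-or-dense : ∀ {m n} (M : BoolMatrix m n) d →
    Degenerate M d ⊎ ∃[ I ] ∃[ J ] Dense M (suc d) I J
  degenerate-or-dense M d with anySubset? (λ I → anySubset? (dense? M (suc d) I))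
  ... | yes dense  = inj₂ dense
  ... | no  ¬dense = inj₁ degenerate
    where
    degenerate : Degenerate M d
    degenerate I J I≠∅ J≠∅
      with Fin.any? (λ i → (i ∈? I) ×-dec (rowOnes M J i ℕ.≤? d))
         | Fin.any? (λ j → (j ∈? J) ×-dec (colOnes M I j ℕ.≤? d))
    ... | yes row | _       = inj₁ row
    ... | no  _   | yes col = inj₂ col
    ... | no ¬row | no ¬col = contradiction
      (I , J , I≠∅ , J≠∅ ,
        (λ i i∈I → ℕ.≰⇒> (λ le → ¬row (i , i∈I , le))) ,
        (λ j j∈J → ℕ.≰⇒> (λ le → ¬col (j , j∈J , le)))) ¬dense

  degeneracy⇒dense : ∀ {m n} (M : BoolMatrix m n) d → HasDegeneracy M (suc d) →
    ∃[ I ] ∃[ J ] Dense M (suc d) I J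
  degeneracy⇒dense M d (_ , minimal) with degenerate-or-dense M d
  ... | inj₁ degenerate = contradiction (minimal d degenerate) (ℕ.<⇒≱ (ℕ.n<1+n d))
  ... | inj₂ dense      = dense

  𝟙-disjoint : ∀ a b c d → ¬ (a ≡ true × b ≡ true × c ≡ true × d ≡ true) →
    (𝟙 a * 𝟙 b) * (𝟙 c * 𝟙 d) ≡ 0ℚ
  𝟙-disjoint false b c d _ = solve 3 (λ b c d → (con 0ℚ :* b) :* (c :* d) := con 0ℚ)
    refl (𝟙 b) (𝟙 c) (𝟙 d)
  𝟙-disjoint true false c d _ = solve 3 (λ a c d → (a :* con 0ℚ) :* (c :* d) := con 0ℚ)
    refl 1ℚ (𝟙 c) (𝟙 d)
  𝟙-disjoint true true false d _ = solve 3 (λ a b d → (a :* b) :* (con 0ℚ :* d) := con 0ℚ)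
    refl 1ℚ 1ℚ (𝟙 d)
  𝟙-disjoint true true true false _ = solve 1 (λ a → (a :* a) :* (a :* con 0ℚ) := con 0ℚ)
    refl 1ℚ
  𝟙-disjoint true true true true ¬all = ⊥-elim (¬all (refl , refl , refl , refl))

  tall-robust : ∀ {m n} (M : BoolMatrix m n) → FourCycleFree M →
    ∀ d κ → κ ℕ.* κ ℕ.≤ 4 ℕ.* suc d → ∀ I J → Dense M (suc d) I J → ∣ J ∣ ℕ.≤ ∣ I ∣ →
    Robust (λ i j → 𝟙 (M i j)) (ℕ→ℚ κ)
  tall-robust M fcf d κ κ²≤ I J (I≠∅ , _ , row , col) J≤I = Robust-restrict (enum I) (enum J)
    (C₄-free-robust (λ i j → 𝟙 (M (enum I i) (enum J j)))
      (λ i j → 𝟙² (M (enum I i) (enum J j)))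
      (λ {i} {i′} {j} {l} i≢ j≢ → 𝟙-disjoint
        (M (enum I i) (enum J j)) (M (enum I i) (enum J l))
        (M (enum I i′) (enum J j)) (M (enum I i′) (enum J l))
        (fcf (i≢ ∘ enum-injective I) (j≢ ∘ enum-injective J)))
      (ℕ→ℚ (suc d)) (ℕ→ℚ κ) (0<ℕ→ℚ-suc d) (0≤ℕ→ℚ κ)
      (subst₂ _≤_ (trans (ℕ→ℚ-* κ κ) (*-homo (ℕ→ℚ κ) (ℕ→ℚ κ)))
        (trans (ℕ→ℚ-* 4 (suc d)) (*-homo 4ℚ (ℕ→ℚ (suc d)))) (ℕ→ℚ-mono κ²≤))
      (λ i → subst (ℕ→ℚ (suc d) ≤_) (sym (sum-enum J (M (enum I i))))
        (ℕ→ℚ-mono (row (enum I i) (enum∈ I i))))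
      (λ j → subst (0ℚ <_) (sym (sum-enum I (λ i → M i (enum J j))))
        (ℚ.<-≤-trans (0<ℕ→ℚ-suc d) (ℕ→ℚ-mono (col (enum J j) (enum∈ J j)))))
      J≤I (0<∣S∣ I≠∅))

  dense⇒robust : ∀ {m n} (M : BoolMatrix m n) → FourCycleFree M →
    ∀ d κ → κ ℕ.* κ ℕ.≤ 4 ℕ.* suc d → ∀ I J → Dense M (suc d) I J →
    Robust (λ i j → 𝟙 (M i j)) (ℕ→ℚ κ)
  dense⇒robust M fcf d κ κ²≤ I J dense@(I≠∅ , J≠∅ , row , col) with ℕ.≤-total ∣ J ∣ ∣ I ∣
  ... | inj₁ J≤I = tall-robust M fcf d κ κ²≤ I J dense J≤I
  ... | inj₂ I≤J = Robust-transpose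
    (tall-robust (λ j i → M i j) (λ j≢ i≢ (a , b , c , e) → fcf i≢ j≢ (a , c , b , e))
      d κ κ²≤ J I (J≠∅ , I≠∅ , col , row) I≤J)

  degeneracy⇒robust : ∀ {m n} (M : BoolMatrix m n) → FourCycleFree M →
    ∀ d κ → κ ℕ.* κ ℕ.≤ 4 ℕ.* d → HasDegeneracy M d →
    Robust (λ i j → 𝟙 (M i j)) (ℕ→ℚ κ)
  degeneracy⇒robust M fcf zero zero _ _ = 0ℚ , ℚ.≤-refl , λ ε u v α β _ 0<α 0<β _ _ _ _ →
    0≤+ (0≤* 0≤9 (0≤* (ℚ.<⇒≤ 0<α) (ℚ.<⇒≤ 0<β))) (ℚ.≤-reflexive (sym (zeroˡ ε)))
  degeneracy⇒robust M fcf zero (suc κ) () _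
  degeneracy⇒robust M fcf (suc d) κ κ²≤ deg =
    let I , J , dense = degeneracy⇒dense M d deg in dense⇒robust M fcf d κ κ²≤ I J dense

  𝟙-mono : ∀ {b c} → (b ≡ true → c ≡ true) → 𝟙 b ≤ 𝟙 c
  𝟙-mono {false} {c}     _   = 0≤𝟙 c
  𝟙-mono {true}  {true}  _   = ℚ.≤-refl
  𝟙-mono {true}  {false} b⇒c = contradiction (b⇒c refl) λ ()

  ∧-elim : ∀ {b c} → b ∧ c ≡ true → b ≡ true × c ≡ true
  ∧-elim {true} {true} _ = refl , refl

  ∧-intro : ∀ {b c} → b ≡ true → c ≡ true → b ∧ c ≡ true
  ∧-intro refl refl = refl

  masked : ∀ {n} → Subset n → (Fin n → Bool) → ℚ
  masked S f = sum λ i → 𝟙 (lookup S i ∧ f i)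

  masked-mono : ∀ {n} {S T : Subset n} {f g : Fin n → Bool} →
    (∀ i → i ∈ S → f i ≡ true → i ∈ T × g i ≡ true) → masked S f ≤ masked T g
  masked-mono {S = S} {T} {f} {g} imp = sum-mono λ i → 𝟙-mono λ eq →
    let Si , fi = ∧-elim {lookup S i} eq
        i∈T , gi = imp i (lookup⇒[]= i S Si) fi
    in ∧-intro ([]=⇒lookup i∈T) gi

  masked-empty : ∀ {n} {S : Subset n} (f : Fin n → Bool) → ¬ Nonempty S → masked S f ≤ 0ℚ
  masked-empty {n} {S} f S≡∅ = subst (masked S f ≤_) (sum-zero n)
    (sum-mono λ i → 𝟙-mono {c = false} λ eq →
      contradiction (i , lookup⇒[]= i S (proj₁ (∧-elim {lookup S i} eq))) S≡∅)

  record Split {m n} (M : BoolMatrix m n) (D : ℚ) (I : Subset m) (J : Subset n) : Set where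
    field
      toRow : Fin m → Fin n → Bool
      rows  : ∀ i → i ∈ I → masked J (λ j → M i j ∧ toRow i j) ≤ D
      cols  : ∀ j → j ∈ J → masked I (λ i → M i j ∧ not (toRow i j)) ≤ D

  Split-transpose : ∀ {m n} {M : BoolMatrix m n} {D I J} →
    Split (λ j i → M i j) D J I → Split M D I J
  Split-transpose {M = M} {D} {I} {J} S = record
    { toRow = λ i j → not (toRow j i)
    ; rows  = cols
    ; cols  = λ j j∈J → subst (_≤ D) (sum-cong-≗ λ i →
        cong (λ b → 𝟙 (lookup I i ∧ (M i j ∧ b))) (sym (Bool.not-involutive (toRow j i))))
        (rows j j∈J)
    }
    where open Split S

  split-row : ∀ {m n} {M : BoolMatrix m n} {d I J} i₀ → rowOnes M J i₀ ℕ.≤ d →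
    Split M (ℕ→ℚ d) (I ─ i₀) J → Split M (ℕ→ℚ d) I J
  split-row {m} {n} {M} {d} {I} {J} i₀ row≤ S = record { toRow = t ; rows = rows′ ; cols = cols′ }
    where
    open Split S
    t : Fin m → Fin n → Bool
    t i j = if does (i Fin.≟ i₀) then true else toRow i j
    rows′ : ∀ i → i ∈ I → masked J (λ j → M i j ∧ t i j) ≤ ℕ→ℚ d
    rows′ i i∈I with i Fin.≟ i₀
    ... | no  i≢i₀ = rows i (x∈p∧x≢y⇒x∈p-y i∈I i≢i₀)
    ... | yes refl = ℚ.≤-trans
      (masked-mono {S = J} {J} {g = M i} (λ j j∈J eq → j∈J , proj₁ (∧-elim {M i j} eq)))
      (subst (_≤ ℕ→ℚ d) (sym (sum-mask J (M i))) (ℕ→ℚ-mono row≤))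
    cols′ : ∀ j → j ∈ J → masked I (λ i → M i j ∧ not (t i j)) ≤ ℕ→ℚ d
    cols′ j j∈J = ℚ.≤-trans (masked-mono {S = I} {I ─ i₀} survives) (cols j j∈J)
      where
      survives : ∀ i → i ∈ I → M i j ∧ not (t i j) ≡ true →
        i ∈ I ─ i₀ × M i j ∧ not (toRow i j) ≡ true
      survives i i∈I eq with i Fin.≟ i₀
      ... | no  i≢i₀ = x∈p∧x≢y⇒x∈p-y i∈I i≢i₀ , eq
      ... | yes refl = contradiction (proj₂ (∧-elim {M i j} eq)) λ ()

  split : ∀ {m n} (M : BoolMatrix m n) d → Degenerate M d →
    ∀ k I J → ∣ I ∣ ℕ.+ ∣ J ∣ ℕ.≤ k → Split M (ℕ→ℚ d) I J
  split M d deg k I J size with nonempty? I | nonempty? J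
  ... | no I≡∅ | _ = record
    { toRow = λ _ _ → true
    ; rows  = λ i i∈I → contradiction (i , i∈I) I≡∅
    ; cols  = λ j _ → ℚ.≤-trans (masked-empty {S = I} (λ i → M i j ∧ false) I≡∅) (0≤ℕ→ℚ d)
    }
  ... | yes _ | no J≡∅ = record
    { toRow = λ _ _ → true
    ; rows  = λ i _ → ℚ.≤-trans (masked-empty {S = J} (λ j → M i j ∧ true) J≡∅) (0≤ℕ→ℚ d)
    ; cols  = λ j j∈J → contradiction (j , j∈J) J≡∅
    }
  split M d deg zero I J size | yes I≠∅ | yes _ =
    contradiction (ℕ.≤-trans (ℕ.m≤m+n ∣ I ∣ ∣ J ∣) size) (ℕ.<⇒≱ (0<∣S∣ I≠∅))
  split M d deg (suc k) I J size | yes I≠∅ | yes J≠∅ with deg I J I≠∅ J≠∅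
  ... | inj₁ (i , i∈I , row≤) = split-row i row≤ (split M d deg k (I ─ i) J
    (ℕ.s≤s⁻¹ (ℕ.≤-trans (ℕ.+-monoˡ-< ∣ J ∣ (x∈p⇒∣p-x∣<∣p∣ i∈I)) size)))
  ... | inj₂ (j , j∈J , col≤) = Split-transpose (split-row j col≤ (Split-transpose
    (split M d deg k I (J ─ j)
      (ℕ.s≤s⁻¹ (ℕ.≤-trans (ℕ.+-monoʳ-< ∣ I ∣ (x∈p⇒∣p-x∣<∣p∣ j∈J)) size)))))

  ++-suc : ∀ {n m} (f : Fin (suc n) → ℚ) (g : Fin m → ℚ) i →
    (f ++ g) (suc i) ≡ ((f ∘ suc) ++ g) i
  ++-suc {n} f g i with splitAt n i
  ... | inj₁ _ = refl
  ... | inj₂ _ = refl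

  ∙-++ : ∀ {n m} (f f′ : Fin n → ℚ) (g g′ : Fin m → ℚ) →
    (f ++ g) ∙ (f′ ++ g′) ≡ f ∙ f′ + g ∙ g′
  ∙-++ {zero}  f f′ g g′ = sym (+-identityˡ (g ∙ g′))
  ∙-++ {suc n} f f′ g g′ = trans
    (cong (f zero * f′ zero +_) (trans
      (sum-cong-≗ (λ i → cong₂ _*_ (++-suc f g i) (++-suc f′ g′ i)))
      (∙-++ (f ∘ suc) (f′ ∘ suc) g g′)))
    (sym (+-assoc (f zero * f′ zero) ((f ∘ suc) ∙ (f′ ∘ suc)) (g ∙ g′)))

  ∙-scale : ∀ {n} a b (f g : Fin n → ℚ) →
    (λ i → a * f i) ∙ (λ i → b * g i) ≡ (a * b) * f ∙ g
  ∙-scale a b f g = trans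
    (sum-cong-≗ (λ i → solve 4 (λ a b x y → (a :* x) :* (b :* y) := (a :* b) :* (x :* y))
      refl a b (f i) (g i)))
    (sym (*-distribˡ-sum (a * b) (λ i → f i * g i)))

  record RationalFactorization {m n} (N : Fin m → Fin n → ℚ) (α β : ℚ) : Set where
    field
      {k}    : ℕ
      u      : Fin m → Fin k → ℚ
      v      : Fin n → Fin k → ℚ
      u∙v    : ∀ i j → u i ∙ v j ≡ N i j
      u-norm : ∀ i → u i ∙ u i ≤ α * α
      v-norm : ∀ j → v j ∙ v j ≤ β * β

  Split⇒rows : ∀ {m n} {M : BoolMatrix m n} {D} (S : Split M D full full) →
    ∀ i → sum (λ j → 𝟙 (M i j ∧ Split.toRow S i j)) ≤ D
  Split⇒rows {M = M} {D} S i = subst (_≤ D)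
    (sum-cong-≗ λ j → cong (λ b → 𝟙 (b ∧ (M i j ∧ Split.toRow S i j))) ([]=⇒lookup (∈⊤ {x = j})))
    (Split.rows S i ∈⊤)

  Split⇒cols : ∀ {m n} {M : BoolMatrix m n} {D} (S : Split M D full full) →
    ∀ j → sum (λ i → 𝟙 (M i j ∧ not (Split.toRow S i j))) ≤ D
  Split⇒cols {M = M} {D} S j = subst (_≤ D)
    (sum-cong-≗ λ i → cong (λ b → 𝟙 (b ∧ (M i j ∧ not (Split.toRow S i j))))
      ([]=⇒lookup (∈⊤ {x = i})))
    (Split.cols S j ∈⊤)

  𝟙-split : ∀ b t → 𝟙 (b ∧ t) + 𝟙 (b ∧ not t) ≡ 𝟙 b
  𝟙-split true  true  = +-identityʳ 1ℚ
  𝟙-split true  false = +-identityˡ 1ℚ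
  𝟙-split false t     = +-identityˡ 0ℚ

  𝟙-sum-² : ∀ {n} (f : Fin n → Bool) → (λ i → 𝟙 (f i)) ∙ (λ i → 𝟙 (f i)) ≡ sum (λ i → 𝟙 (f i))
  𝟙-sum-² f = sum-cong-≗ (λ i → 𝟙² (f i))

  zero-factorization : ∀ {m n} (M : BoolMatrix m n) → Split M 0ℚ full full → ∀ α β →
    RationalFactorization (λ i j → 𝟙 (M i j)) α β
  zero-factorization M S α β = record
    { k      = 0
    ; u      = λ i ()
    ; v      = λ j ()
    ; u∙v    = λ i j → ℚ.≤-antisym (0≤𝟙 (M i j)) (subst (_≤ 0ℚ) (𝟙-split (M i j) (toRow i j))
        (ℚ.≤-trans
          (+-mono-≤
            (ℚ.≤-trans (term≤sum (λ j → 0≤𝟙 (M i j ∧ toRow i j)) j) (Split⇒rows S i))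
            (ℚ.≤-trans (term≤sum (λ i → 0≤𝟙 (M i j ∧ not (toRow i j))) i) (Split⇒cols S j)))
          (ℚ.≤-reflexive (+-identityˡ 0ℚ))))
    ; u-norm = λ _ → 0≤p² α
    ; v-norm = λ _ → 0≤p² β
    }
    where open Split S

  -- M = M₁ + M₂ with short rows in M₁ and short columns in M₂ is [ M₁ | a ] [ 1 / a⁻¹ M₂ ];
  -- a of order √D balances the norms of the two factors.

  split-factorization : ∀ {m n} (M : BoolMatrix m n) D a → Split M D full full →
    0ℚ < a → D ≤ a * a → RationalFactorization (λ i j → 𝟙 (M i j)) (2ℚ * a) 2ℚ
  split-factorization {m} {n} M D a S 0<a D≤a² = record
    { u      = λ i → M₁ i ++ (λ l → a * δ i l)
    ; v      = λ j → δ j ++ (λ l → b * M₂ j l)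
    ; u∙v    = λ i j → begin-equality
        (M₁ i ++ (λ l → a * δ i l)) ∙ (δ j ++ (λ l → b * M₂ j l))
          ≡⟨ ∙-++ (M₁ i) (δ j) (λ l → a * δ i l) (λ l → b * M₂ j l) ⟩
        M₁ i ∙ δ j + (λ l → a * δ i l) ∙ (λ l → b * M₂ j l)
          ≡⟨ cong₂ _+_ (trans (∙-comm (M₁ i) (δ j)) (δ-∙ j (M₁ i)))
               (trans (∙-scale a b (δ i) (M₂ j))
                 (trans (cong₂ _*_ ab≡1 (δ-∙ i (M₂ j))) (*-identityˡ (M₂ j i)))) ⟩
        M₁ i j + M₂ j i
          ≡⟨ 𝟙-split (M i j) (toRow i j) ⟩
        𝟙 (M i j) ∎
    ; u-norm = λ i → begin
        (M₁ i ++ (λ l → a * δ i l)) ∙ (M₁ i ++ (λ l → a * δ i l))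
          ≡⟨ ∙-++ (M₁ i) (M₁ i) (λ l → a * δ i l) (λ l → a * δ i l) ⟩
        M₁ i ∙ M₁ i + (λ l → a * δ i l) ∙ (λ l → a * δ i l)
          ≡⟨ cong₂ _+_ (𝟙-sum-² (λ j → M i j ∧ toRow i j))
               (trans (∙-scale a a (δ i) (δ i)) (cong ((a * a) *_) (δ-norm i))) ⟩
        sum (M₁ i) + (a * a) * 1ℚ
          ≤⟨ +-mono-≤ (ℚ.≤-trans (Split⇒rows S i) D≤a²) ℚ.≤-refl ⟩
        a * a + (a * a) * 1ℚ
          ≤⟨ 0≤q-p⇒p≤q (subst (0ℚ ≤_)
               (solve 1 (λ a → con 2ℚ :* (a :* a) := (con 2ℚ :* a) :* (con 2ℚ :* a)
                 :- (a :* a :+ (a :* a) :* con 1ℚ)) refl a) (0≤* 0≤2 (0≤p² a))) ⟩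
        (2ℚ * a) * (2ℚ * a) ∎
    ; v-norm = λ j → begin
        (δ j ++ (λ l → b * M₂ j l)) ∙ (δ j ++ (λ l → b * M₂ j l))
          ≡⟨ ∙-++ (δ j) (δ j) (λ l → b * M₂ j l) (λ l → b * M₂ j l) ⟩
        δ j ∙ δ j + (λ l → b * M₂ j l) ∙ (λ l → b * M₂ j l)
          ≡⟨ cong₂ _+_ (δ-norm j) (trans (∙-scale b b (M₂ j) (M₂ j))
               (cong ((b * b) *_) (𝟙-sum-² (λ i → M i j ∧ not (toRow i j))))) ⟩
        1ℚ + (b * b) * sum (M₂ j)
          ≤⟨ +-mono-≤ ℚ.≤-refl (*-monoˡ (b * b) (0≤p² b) (ℚ.≤-trans (Split⇒cols S j) D≤a²)) ⟩
        1ℚ + (b * b) * (a * a)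
          ≡⟨ cong (1ℚ +_) (trans
               (solve 2 (λ a b → (b :* b) :* (a :* a) := (a :* b) :* (a :* b)) refl a b)
               (trans (cong₂ _*_ ab≡1 ab≡1) (*-identityˡ 1ℚ))) ⟩
        1ℚ + 1ℚ
          ≤⟨ 0≤q-p⇒p≤q (subst (0ℚ ≤_)
               (solve 0 (con 2ℚ := con 2ℚ :* con 2ℚ :- (con 1ℚ :+ con 1ℚ)) refl) 0≤2) ⟩
        2ℚ * 2ℚ ∎
    }
    where
    open ℚ.≤-Reasoning
    open Split S
    b = proj₁ (inverse 0<a)
    ab≡1 : a * b ≡ 1ℚ
    ab≡1 = proj₂ (proj₂ (inverse 0<a))
    M₁ : Fin m → Fin n → ℚ
    M₁ i j = 𝟙 (M i j ∧ toRow i j)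
    M₂ : Fin n → Fin m → ℚ
    M₂ j i = 𝟙 (M i j ∧ not (toRow i j))
    δ-norm : ∀ {n} (j : Fin n) → δ j ∙ δ j ≡ 1ℚ
    δ-norm j = trans (δ-∙ j (δ j)) (δ-refl j)

  degenerate⇒factorization : ∀ {m n} (M : BoolMatrix m n) d κ → d ℕ.≤ κ ℕ.* κ →
    Degenerate M d → RationalFactorization (λ i j → 𝟙 (M i j)) (2ℚ * ℕ→ℚ κ) 2ℚ
  degenerate⇒factorization M zero κ d≤ deg =
    zero-factorization M (split M 0 deg _ full full ℕ.≤-refl) (2ℚ * ℕ→ℚ κ) 2ℚ
  degenerate⇒factorization M (suc d) (suc κ) d≤ deg =
    split-factorization M (ℕ→ℚ (suc d)) (ℕ→ℚ (suc κ)) (split M (suc d) deg _ full full ℕ.≤-refl)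
      (0<ℕ→ℚ-suc κ)
      (subst (ℕ→ℚ (suc d) ≤_) (trans (ℕ→ℚ-* (suc κ) (suc κ)) (*-homo (ℕ→ℚ (suc κ)) (ℕ→ℚ (suc κ))))
        (ℕ→ℚ-mono d≤))

  √-approx : ∀ d → ∃[ κ ] d ℕ.≤ κ ℕ.* κ × κ ℕ.* κ ℕ.≤ 4 ℕ.* d
  √-approx zero = 0 , ℕ.z≤n , ℕ.z≤n
  √-approx (suc d) with √-approx d
  ... | κ , d≤ , ≤4d with suc d ℕ.≤? κ ℕ.* κ
  ...   | yes sd≤ = κ , sd≤ , ℕ.≤-trans ≤4d (ℕ.*-monoʳ-≤ 4 (ℕ.n≤1+n d))
  ...   | no  sd≰ = suc κ ,
    ℕ.s≤s (ℕ.≤-trans d≤ (ℕ.≤-trans (ℕ.*-monoʳ-≤ κ (ℕ.n≤1+n κ)) (ℕ.m≤n+m _ κ))) ,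
    (begin
      suc κ ℕ.* suc κ
        ≡⟨ S.solve 1 (λ κ → (S.con 1 S.:+ κ) S.:* (S.con 1 S.:+ κ)
             S.:= S.con 1 S.:+ (κ S.:* κ S.:+ S.con 2 S.:* κ)) refl κ ⟩
      1 ℕ.+ (κ ℕ.* κ ℕ.+ 2 ℕ.* κ)
        ≤⟨ ℕ.+-monoʳ-≤ 1 (ℕ.+-mono-≤ κ²≤d (ℕ.*-monoʳ-≤ 2 (ℕ.≤-trans (κ≤κ² κ) κ²≤d))) ⟩
      1 ℕ.+ (d ℕ.+ 2 ℕ.* d)
        ≤⟨ ℕ.m≤m+n _ (3 ℕ.+ d) ⟩
      1 ℕ.+ (d ℕ.+ 2 ℕ.* d) ℕ.+ (3 ℕ.+ d)
        ≡⟨ S.solve 1 (λ d → S.con 1 S.:+ (d S.:+ S.con 2 S.:* d) S.:+ (S.con 3 S.:+ d)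
             S.:= S.con 4 S.:* (S.con 1 S.:+ d)) refl d ⟩
      4 ℕ.* suc d ∎)
    where
    open ℕ.≤-Reasoning
    module S = +-*-Solver
    κ²≤d : κ ℕ.* κ ℕ.≤ d
    κ²≤d = ℕ.s≤s⁻¹ (ℕ.≰⇒> sd≰)
    κ≤κ² : ∀ κ → κ ℕ.≤ κ ℕ.* κ
    κ≤κ² zero    = ℕ.z≤n
    κ≤κ² (suc κ) = ℕ.m≤m*n (suc κ) (suc κ)

module Reals where

  open import Data.Bool.Base using (true; false)
  open import Data.Fin.Base using (Fin; zero; suc)
  import Data.Integer.Base as ℤ
  open import Data.Nat.Base as ℕ using (ℕ; zero; suc)
  import Data.Nat.Properties as ℕ
  open import Data.Product using (∃-syntax; _×_; _,_; proj₁; proj₂)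
  open import Data.Rational.Base as ℚ using ()
  import Data.Rational.Properties as ℚₚ
  open import Data.Sum using (inj₁; inj₂)
  import Defs as D
  open D using (ℕ→ℚ; 1/suc; sqrtℚ; seq; Eventually; BoolMatrix; toReal; Root; Factorization)
  open import Relation.Binary.PropositionalEquality
  open import Relation.Nullary using (yes; no; contradiction)
  open Rational
  open Counting using (𝟙)

  neg-involutive : ∀ p → - (- p) ≡ p
  neg-involutive = solve 1 (λ p → :- (:- p) := p) refl

  opaque
    unfolding _+_

    *≤*+ : ∀ {a b c d e} → a * b ≤ c * d + e → a ℚ.* b ℚ.≤ c ℚ.* d ℚ.+ e
    *≤*+ h = h

    p≤[r+δ]² : ∀ {δ q r} → Root δ q r → q ≤ (r + δ) * (r + δ)
    p≤[r+δ]² R = ℚₚ.<⇒≤ (Root.q< R)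

    r²≤p : ∀ {δ q r} → Root δ q r → r * r ≤ q
    r²≤p R = Root.r²≤q R

    ∣p-q∣<-elim : ∀ {p q ε} → ℚ.∣ p ℚ.- q ∣ < ε → (- ε ≤ p - q) × (p - q ≤ ε)
    ∣p-q∣<-elim {p} {q} {ε} h with ℚₚ.∣p∣≡p∨∣p∣≡-p (p ℚ.- q)
    ... | inj₁ eq = ℚₚ.≤-trans (ℚₚ.neg-antimono-≤ 0≤ε) 0≤p-q , ℚₚ.<⇒≤ (subst (_< ε) eq h)
      where
      0≤ε : 0ℚ ≤ ε
      0≤ε = ℚₚ.≤-trans (ℚₚ.0≤∣p∣ (p ℚ.- q)) (ℚₚ.<⇒≤ h)
      0≤p-q : 0ℚ ≤ p ℚ.- q
      0≤p-q = subst (0ℚ ≤_) eq (ℚₚ.0≤∣p∣ (p ℚ.- q))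
    ... | inj₂ eq =
      subst (- ε ≤_) (neg-involutive (p - q))
        (ℚₚ.neg-antimono-≤ (ℚₚ.<⇒≤ (subst (_< ε) eq h))) ,
      subst (_≤ ε) (neg-involutive (p - q))
        (ℚₚ.≤-trans (ℚₚ.neg-antimono-≤ (subst (0ℚ ≤_) eq (ℚₚ.0≤∣p∣ (p ℚ.- q))))
          (ℚₚ.≤-trans (ℚₚ.0≤∣p∣ (p ℚ.- q)) (ℚₚ.<⇒≤ h)))

    ∣p-p∣< : ∀ {p q ε} → p ≡ q → 0ℚ < ε → ℚ.∣ p ℚ.- q ∣ < ε
    ∣p-p∣< {p} refl 0<ε = subst (_< _) (sym (cong ℚ.∣_∣ (ℚₚ.+-inverseʳ p))) 0<ε

  ²-cancel-≤ : ∀ {r R} → 0ℚ ≤ R → r * r ≤ R * R → r ≤ R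
  ²-cancel-≤ {r} {R} 0≤R r²≤R² with r ℚₚ.≤? R
  ... | yes r≤R = r≤R
  ... | no  r≰R = contradiction (ℚₚ.<-≤-trans R²<r² r²≤R²) (ℚₚ.<-irrefl refl)
    where
    R<r : R < r
    R<r = ℚₚ.≰⇒> r≰R
    R²<r² : R * R < r * r
    R²<r² = ℚₚ.≤-<-trans (*-monoˡ R 0≤R (ℚₚ.<⇒≤ R<r))
      (subst (_< r * r) (*-comm r R) (*-monoˡ-< r (ℚₚ.≤-<-trans 0≤R R<r) R<r))

  root : ∀ t q → Root (1/suc t) (q ℚ.⊔ 0ℚ) (sqrtℚ t (q ℚ.⊔ 0ℚ))
  root t q = D.sqrtℚ-root t (q ℚ.⊔ 0ℚ) (ℚₚ.p≤q⊔p q 0ℚ)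

  sqrt≤ : ∀ t {q R} → 0ℚ ≤ R → q ≤ R * R → sqrtℚ t (q ℚ.⊔ 0ℚ) ≤ R
  sqrt≤ t {q} {R} 0≤R q≤R² =
    ²-cancel-≤ 0≤R (ℚₚ.≤-trans (r²≤p (root t q)) (ℚₚ.⊔-lub q≤R² (0≤p² R)))

  0≤sqrt : ∀ t q → 0ℚ ≤ sqrtℚ t (q ℚ.⊔ 0ℚ)
  0≤sqrt t q = Root.0≤r (root t q)

  sqrt-< : ∀ t q → q ≤ (sqrtℚ t (q ℚ.⊔ 0ℚ) + 1/suc t) * (sqrtℚ t (q ℚ.⊔ 0ℚ) + 1/suc t)
  sqrt-< t q = ℚₚ.≤-trans (ℚₚ.p≤p⊔q q 0ℚ) (p≤[r+δ]² (root t q))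

  0≤1/suc : ∀ t → 0ℚ ≤ 1/suc t
  0≤1/suc t = ℚₚ.<⇒≤ (D.0<1/suc t)

  seq-∙ : ∀ {k} (f g : Fin k → D.ℝ) t →
    seq (D.sum λ l → f l D.* g l) t ≡ (λ l → seq (f l) t) ∙ (λ l → seq (g l) t)
  seq-∙ {zero}  f g t = refl
  seq-∙ {suc k} f g t = trans (+-homo (seq (f zero) t ℚ.* seq (g zero) t) _)
    (cong₂ _+_ (*-homo (seq (f zero) t) (seq (g zero) t))
      (seq-∙ (λ l → f (suc l)) (λ l → g (suc l)) t))

  max≤ : ∀ {n} (f : Fin n → D.ℝ) t {R} → 0ℚ ≤ R → (∀ i → seq (f i) t ≤ R) → seq (D.max f) t ≤ R
  max≤ {zero}  f t 0≤R f≤ = 0≤R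
  max≤ {suc n} f t 0≤R f≤ = ℚₚ.⊔-lub (f≤ zero) (max≤ (λ i → f (suc i)) t 0≤R (λ i → f≤ (suc i)))

  ≤max : ∀ {n} (f : Fin n → D.ℝ) t i → seq (f i) t ≤ seq (D.max f) t
  ≤max f t zero    = ℚₚ.p≤p⊔q (seq (f zero) t) _
  ≤max f t (suc i) = ℚₚ.≤-trans (≤max (λ i → f (suc i)) t i) (ℚₚ.p≤q⊔p (seq (f zero) t) _)

  0≤max : ∀ {n} (f : Fin n → D.ℝ) t → 0ℚ ≤ seq (D.max f) t
  0≤max {zero}  f t = ℚₚ.≤-refl
  0≤max {suc n} f t = ℚₚ.≤-trans (0≤max (λ i → f (suc i)) t) (ℚₚ.p≤q⊔p (seq (f zero) t) _)

  norm≤ : ∀ {k} (v : Fin k → D.ℝ) t {R} → 0ℚ ≤ R →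
    (λ l → seq (v l) t) ∙ (λ l → seq (v l) t) ≤ R * R → seq (D.‖ v ‖₂) t ≤ R
  norm≤ v t {R} 0≤R v∙v≤ = sqrt≤ t 0≤R (subst (_≤ R * R) (sym (seq-∙ v v t)) v∙v≤)

  ∙≤norm : ∀ {k} (v : Fin k → D.ℝ) t {α} → seq (D.‖ v ‖₂) t ≤ α →
    (λ l → seq (v l) t) ∙ (λ l → seq (v l) t) ≤ (α + 1/suc t) * (α + 1/suc t)
  ∙≤norm v t {α} ‖v‖≤ = subst (_≤ (α + 1/suc t) * (α + 1/suc t)) (seq-∙ v v t)
    (ℚₚ.≤-trans (sqrt-< t q) (*-mono 0≤s+δ 0≤s+δ s+δ≤ s+δ≤))
    where
    q = seq (D.sum λ l → v l D.* v l) t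
    s = seq (D.‖ v ‖₂) t
    0≤s+δ : 0ℚ ≤ s + 1/suc t
    0≤s+δ = 0≤+ (0≤sqrt t q) (0≤1/suc t)
    s+δ≤ : s + 1/suc t ≤ α + 1/suc t
    s+δ≤ = +-mono-≤ ‖v‖≤ (ℚₚ.≤-refl {1/suc t})

  seq-toReal : ∀ {m n} (M : BoolMatrix m n) i j t → seq (toReal M i j) t ≡ 𝟙 (M i j)
  seq-toReal M i j t with M i j
  ... | true  = refl
  ... | false = refl

  Eventually-∀ : ∀ {n} {P : Fin n → ℕ → Set} → (∀ i → Eventually (P i)) →
    Eventually λ t → ∀ i → P i t
  Eventually-∀ {zero}  h = 0 , λ t _ ()
  Eventually-∀ {suc n} h with h zero | Eventually-∀ (λ i → h (suc i))
  ... | N , p | N′ , q = N ℕ.⊔ N′ , λ where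
    t le zero    → p t (ℕ.m⊔n≤o⇒m≤o N N′ le)
    t le (suc i) → q t (ℕ.m⊔n≤o⇒n≤o N N′ le) i

  eventually-bounded : ∀ x → Eventually (λ t → 0ℚ ≤ seq x t) →
    ∃[ B ] 0ℚ ≤ B × Eventually λ t → seq x t ≤ B
  eventually-bounded x (K , 0≤x) with D.cauchy x 1ℚ 0<1
  ... | N , h = seq x L + 1ℚ , 0≤+ (0≤x L (ℕ.m≤m⊔n K N)) 0≤1 , L , λ t le →
    subst (_≤ seq x L + 1ℚ) (solve 2 (λ a b → b :+ (a :- b) := a) refl (seq x t) (seq x L))
      (+-mono-≤ (ℚₚ.≤-refl {seq x L})
        (proj₂ (∣p-q∣<-elim (h t L (ℕ.m⊔n≤o⇒n≤o K N le) (ℕ.m≤n⊔m K N)))))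
    where L = K ℕ.⊔ N

  small : ∀ {W ε} → 0ℚ ≤ W → 0ℚ < ε → ∃[ x ] 0ℚ < x × W * x ≤ ε
  small {W} {ε} 0≤W 0<ε with inverse (0<+ 0<1 0≤W)
  ... | y , 0<y , eq = ε * y , 0<* 0<ε 0<y , 0≤q-p⇒p≤q (subst (0ℚ ≤_)
    (trans (solve 3 (λ ε y W → ε :* y := ε :* ((con 1ℚ :+ W) :* y) :- W :* (ε :* y)) refl ε y W)
      (cong (λ z → z - W * (ε * y)) (trans (cong (ε *_) eq) (*-identityʳ ε))))
    (ℚₚ.<⇒≤ (0<* 0<ε 0<y)))

  8ℚ : ℚ
  8ℚ = ℤ.+ 8 ℚ./ 1

  0<8 : 0ℚ < 8ℚ
  0<8 = ℚₚ.positive⁻¹ 8ℚ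

  0≤8 : 0ℚ ≤ 8ℚ
  0≤8 = ℚₚ.<⇒≤ 0<8

  0<fromℚ : ∀ {q} → 0ℚ < q → D.0ℝ D.< D.fromℚ q
  0<fromℚ {q} 0<q = D.mk< q 0<q (0 , λ _ _ → ℚₚ.≤-reflexive (ℚₚ.+-identityˡ q))

  ℕ→ℚ-² : ∀ κ → ℕ→ℚ (κ ℕ.* κ) ≡ ℕ→ℚ κ * ℕ→ℚ κ
  ℕ→ℚ-² κ = trans (D.ℕ→ℚ-* κ κ) (*-homo (ℕ→ℚ κ) (ℕ→ℚ κ))

  γ₂-upper : ∀ {m n} (M : BoolMatrix m n) d κ → κ ℕ.* κ ℕ.≤ 4 ℕ.* d →
    Counting.RationalFactorization (λ i j → 𝟙 (M i j)) (2ℚ * ℕ→ℚ κ) 2ℚ →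
    toReal M D.γ₂≤ (D.fromℚ 8ℚ D.* D.√ D.fromℕ d)
  γ₂-upper M d κ κ²≤ fac = F , D.mk≤ λ ε 0<ε →
    let x , 0<x , 8x≤ε = small 0≤8 0<ε
        N , 1/suc≤ = D.1/suc-small x 0<x
    in N , λ t N≤t → *≤*+ (begin
      seq (D.‖ U ‖row) t * seq (D.‖ V ‖col) t
        ≤⟨ *-mono (0≤max (λ i → D.‖ U i ‖₂) t) (0≤max (λ j → D.‖ (λ l → V l j) ‖₂) t)
             (max≤ _ t 0≤2a (λ i → norm≤ (U i) t 0≤2a (u-norm i)))
             (max≤ _ t 0≤2 (λ j → norm≤ (λ l → V l j) t 0≤2 (v-norm j))) ⟩
      (2ℚ * a) * 2ℚ
        ≡⟨ solve 1 (λ a → (con 2ℚ :* a) :* con 2ℚ := con 4ℚ :* a) refl a ⟩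
      4ℚ * a
        ≤⟨ *-monoˡ 4ℚ 0≤4 (a≤ t) ⟩
      4ℚ * (2ℚ * (s t + 1/suc t))
        ≡⟨ solve 2 (λ s δ → con 4ℚ :* (con 2ℚ :* (s :+ δ)) := con 8ℚ :* s :+ con 8ℚ :* δ)
             refl (s t) (1/suc t) ⟩
      8ℚ * s t + 8ℚ * 1/suc t
        ≤⟨ +-mono-≤ ℚₚ.≤-refl (ℚₚ.≤-trans (*-monoˡ 8ℚ 0≤8 (1/suc≤ t N≤t)) 8x≤ε) ⟩
      8ℚ * s t + ε ∎)
    where
    open ℚₚ.≤-Reasoning
    open Counting.RationalFactorization fac
    a = ℕ→ℚ κ
    0≤2a : 0ℚ ≤ 2ℚ * a
    0≤2a = 0≤* 0≤2 (D.0≤ℕ→ℚ κ)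
    U : D.Matrix _ k
    U i l = D.fromℚ (u i l)
    V : D.Matrix k _
    V l j = D.fromℚ (v j l)
    F : Factorization (toReal M)
    F = record
      { k = k ; U = U ; V = V
      ; UV = λ i j → D.mk≈ λ ε 0<ε → 0 , λ t _ → ∣p-p∣<
          (trans (seq-∙ (U i) (λ l → V l j) t) (trans (u∙v i j) (sym (seq-toReal M i j t)))) 0<ε
      }
    s : ℕ → ℚ
    s t = sqrtℚ t (ℕ→ℚ d ℚ.⊔ 0ℚ)
    a≤ : ∀ t → a ≤ 2ℚ * (s t + 1/suc t)
    a≤ t = ²-cancel-≤ (0≤* 0≤2 (0≤+ (0≤sqrt t (ℕ→ℚ d)) (0≤1/suc t))) (begin
      a * a              ≡⟨ sym (ℕ→ℚ-² κ) ⟩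
      ℕ→ℚ (κ ℕ.* κ)      ≤⟨ Counting.ℕ→ℚ-mono κ²≤ ⟩
      ℕ→ℚ (4 ℕ.* d)      ≡⟨ trans (D.ℕ→ℚ-* 4 d) (*-homo 4ℚ (ℕ→ℚ d)) ⟩
      4ℚ * ℕ→ℚ d         ≤⟨ *-monoˡ 4ℚ 0≤4 (sqrt-< t (ℕ→ℚ d)) ⟩
      4ℚ * ((s t + 1/suc t) * (s t + 1/suc t))
                         ≡⟨ solve 1 (λ x → con 4ℚ :* (x :* x) := (con 2ℚ :* x) :* (con 2ℚ :* x))
                              refl (s t + 1/suc t) ⟩
      (2ℚ * (s t + 1/suc t)) * (2ℚ * (s t + 1/suc t)) ∎)

  γ₂-lower : ∀ {m n} (M : BoolMatrix m n) d κ → d ℕ.≤ κ ℕ.* κ →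
    Robust (λ i j → 𝟙 (M i j)) (ℕ→ℚ κ) →
    (D.fromℚ 1/9 D.* D.√ D.fromℕ d) D.≤γ₂ toReal M
  γ₂-lower {m} {n} M d κ d≤κ² (W , 0≤W , robust) F = D.mk≤ λ ε 0<ε →
    let x , 0<x , Wx≤ = small 0≤W (0<* 0<½ 0<ε)
        A , 0≤A , NA , α≤A = eventually-bounded (D.‖ U ‖row) (0 , λ t _ → 0≤α t)
        B , 0≤B , NB , β≤B = eventually-bounded (D.‖ V ‖col) (0 , λ t _ → 0≤β t)
        C = (A + B) + 1ℚ
        0≤C = 0≤+ (0≤+ 0≤A 0≤B) 0≤1
        y , 0<y , Cy≤ = small 0≤C (0<* 0<½ 0<ε)
        Ny , δ≤y = D.1/suc-small y 0<y
        N₁ , δ≤1 = D.1/suc-small 1ℚ 0<1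
        NUV , UV≈ = Eventually-∀ (λ i → Eventually-∀ (λ j → D.close (UV i j) x 0<x))
    in (NA ℕ.⊔ NB) ℕ.⊔ (Ny ℕ.⊔ (N₁ ℕ.⊔ NUV)) , λ t le →
      let le₁ = ℕ.m⊔n≤o⇒m≤o (NA ℕ.⊔ NB) _ le
          le₂ = ℕ.m⊔n≤o⇒n≤o (NA ℕ.⊔ NB) _ le
          le₃ = ℕ.m⊔n≤o⇒n≤o Ny (N₁ ℕ.⊔ NUV) le₂
          entry = λ i j → ∣p-q∣<-elim (UV≈ t (ℕ.m⊔n≤o⇒n≤o N₁ NUV le₃) i j)
          entry≡ = λ i j → cong₂ _-_ (seq-∙ (U i) (λ l → V l j) t) (seq-toReal M i j t)
          bound = robust x (λ i l → seq (U i l) t) (λ j l → seq (V l j) t)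
            (α t + 1/suc t) (β t + 1/suc t) (ℚₚ.<⇒≤ 0<x)
            (0<α+δ t) (0<β+δ t)
            (λ i → ∙≤norm (U i) t (≤max (λ i → D.‖ U i ‖₂) t i))
            (λ j → ∙≤norm (λ l → V l j) t (≤max (λ j → D.‖ (λ l → V l j) ‖₂) t j))
            (λ i j → subst (- x ≤_) (entry≡ i j) (proj₁ (entry i j)))
            (λ i j → subst (_≤ x) (entry≡ i j) (proj₂ (entry i j)))
      in *≤*+ (final t ε bound Wx≤ 0≤C
           (α≤A t (ℕ.m⊔n≤o⇒m≤o NA NB le₁)) (β≤B t (ℕ.m⊔n≤o⇒n≤o NA NB le₁))
           (δ≤1 t (ℕ.m⊔n≤o⇒m≤o N₁ NUV le₃)) (δ≤y t (ℕ.m⊔n≤o⇒m≤o Ny (N₁ ℕ.⊔ NUV) le₂)) Cy≤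
           (0≤* 0≤W (ℚₚ.<⇒≤ 0<x)))
    where
    open ℚₚ.≤-Reasoning
    open Factorization F
    0<½ : 0ℚ < ½
    0<½ = ℚₚ.positive⁻¹ ½
    α β s : ℕ → ℚ
    α t = seq (D.‖ U ‖row) t
    β t = seq (D.‖ V ‖col) t
    s t = sqrtℚ t (ℕ→ℚ d ℚ.⊔ 0ℚ)
    0≤α : ∀ t → 0ℚ ≤ α t
    0≤α t = 0≤max (λ i → D.‖ U i ‖₂) t
    0≤β : ∀ t → 0ℚ ≤ β t
    0≤β t = 0≤max (λ j → D.‖ (λ l → V l j) ‖₂) t
    0<α+δ : ∀ t → 0ℚ < α t + 1/suc t
    0<α+δ t = subst (0ℚ <_) (+-comm (1/suc t) (α t)) (0<+ (D.0<1/suc t) (0≤α t))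
    0<β+δ : ∀ t → 0ℚ < β t + 1/suc t
    0<β+δ t = subst (0ℚ <_) (+-comm (1/suc t) (β t)) (0<+ (D.0<1/suc t) (0≤β t))
    s≤κ : ∀ t → s t ≤ ℕ→ℚ κ
    s≤κ t = sqrt≤ t (D.0≤ℕ→ℚ κ) (subst (ℕ→ℚ d ≤_) (ℕ→ℚ-² κ) (Counting.ℕ→ℚ-mono d≤κ²))
    final : ∀ t ε {x y A B} →
      ℕ→ℚ κ ≤ 9ℚ * ((α t + 1/suc t) * (β t + 1/suc t)) + W * x → W * x ≤ ½ * ε →
      0ℚ ≤ (A + B) + 1ℚ → α t ≤ A → β t ≤ B → 1/suc t ≤ 1ℚ → 1/suc t ≤ y →
      ((A + B) + 1ℚ) * y ≤ ½ * ε → 0ℚ ≤ W * x →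
      1/9 * s t ≤ α t * β t + ε
    final t ε {x} {y} {A} {B} bound Wx≤ 0≤C α≤A β≤B δ≤1 δ≤y Cy≤ 0≤Wx = begin
      1/9 * s t
        ≤⟨ *-monoˡ 1/9 0≤1/9 (ℚₚ.≤-trans (s≤κ t) bound) ⟩
      1/9 * (9ℚ * ((α t + δₜ) * (β t + δₜ)) + W * x)
        ≡⟨ solve 4 (λ a b δ w → con 1/9 :* (con 9ℚ :* ((a :+ δ) :* (b :+ δ)) :+ w)
             := (a :* b :+ ((a :+ b) :+ δ) :* δ) :+ con 1/9 :* w) refl (α t) (β t) δₜ (W * x) ⟩
      (α t * β t + ((α t + β t) + δₜ) * δₜ) + 1/9 * (W * x)
        ≤⟨ +-mono-≤ (+-mono-≤ ℚₚ.≤-refl δ-error)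
             (0≤q-p⇒p≤q (subst (0ℚ ≤_)
               (solve 2 (λ e w → (e :- w) :+ con 8/9 :* w := e :- con 1/9 :* w)
                 refl (½ * ε) (W * x))
               (0≤+ (p≤q⇒0≤q-p Wx≤) (0≤* (ℚₚ.nonNegative⁻¹ 8/9) 0≤Wx)))) ⟩
      (α t * β t + ½ * ε) + ½ * ε
        ≡⟨ solve 2 (λ a e → (a :+ con ½ :* e) :+ con ½ :* e := a :+ e) refl (α t * β t) ε ⟩
      α t * β t + ε ∎
      where
      8/9 : ℚ
      8/9 = ℤ.+ 8 ℚ./ 9
      δₜ = 1/suc t
      δ-error : ((α t + β t) + δₜ) * δₜ ≤ ½ * ε
      δ-error = ℚₚ.≤-trans
        (*-mono (0≤+ (0≤+ (0≤α t) (0≤β t)) (0≤1/suc t)) (0≤1/suc t)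
          (+-mono-≤ (+-mono-≤ α≤A β≤B) δ≤1) δ≤y) Cy≤

open import Defs
open import Data.Nat.Base using (ℕ)
open import Data.Product using (∃-syntax; _×_; _,_)

theorem1p4 : ∃[ c ] ∃[ C ] 0ℝ < c × 0ℝ < C ×
    (∀ {m n : ℕ} (M : BoolMatrix m n) (d : ℕ) →
    FourCycleFree M → HasDegeneracy M d →
    ((c * √ fromℕ d) ≤γ₂ toReal M) × (toReal M γ₂≤ (C * √ fromℕ d)))
theorem1p4 = fromℚ Rational.1/9 , fromℚ Reals.8ℚ ,
  Reals.0<fromℚ Rational.0<1/9 , Reals.0<fromℚ Reals.0<8 ,
  λ M d fcf deg@(degenerate , _) →
    let κ , d≤κ² , κ²≤4d = Counting.√-approx d
    in Reals.γ₂-lower M d κ d≤κ² (Counting.degeneracy⇒robust M fcf d κ κ²≤4d deg)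
     , Reals.γ₂-upper M d κ κ²≤4d (Counting.degenerate⇒factorization M d κ d≤κ² degenerate)
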